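{- Let $G$ be a $2$-tree-connected graph, let $X\subseteq V(G)$ be an independent set, and let $f$ be a positive integer-valued function on $X$. Suppose that for every $S\subseteq X$, either $G$ has a spanning closed trail meeting each $v\in S$ at most $f(v)$ times, or $$\tfrac{1}{2}\Omega_2(G\setminus S)\le \sum_{v\in S}\big(f(v)-\tfrac{1}{2}\big)+1.$$ Then $G$ has a spanning closed trail meeting each $v\in X$ at most $f(v)$ times.
   Context: Graphs are finite, loopless, and may have multiple edges. A graph is $m$-tree-connected if it contains $m$ pairwise edge-disjoint spanning trees (a one-vertex graph is $m$-tree-connected). The $m$-tree-connected components are the maximal induced $m$-tree-connected subgraphs; their vertex sets partition the vertex set. For a partition $P$ of $V(H)$, $e_H(P)$ is the number of edges with ends in different parts; $\Omega_m(H)=m|P|-e_H(P)$ for $P$ the partition into vertex sets of the $m$-tree-connected components ($\Omega_m=0$ for the graph with no vertices). $G\setminus S$ is obtained by deleting $S$. A set is independent if no edge joins two of its vertices. A spanning closed trail is a closed trail (no repeated edges) passing through all vertices; it meets a vertex $v$ at most $f(v)$ times if it passes through $v$ at most $f(v)$ times. -}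

module Defs where

open import Data.Nat using (ℕ; zero; suc; _+_; _*_; _∸_; _<_; _≤_)
open import Data.Integer as ℤ using (ℤ; +_)
open import Data.Fin using (Fin)
open import Data.Fin.Subset using (Subset; _∈_; _∉_; ∁)
open import Data.Fin.Subset.Properties using (_∈?_)
open import Data.Fin.Properties using (_≟_)
open import Data.List using (List; []; _∷_; map; length; filter; allFin)
open import Data.Nat.ListAction using (sum)
open import Data.List.Membership.Propositional using () renaming (_∈_ to _∈ˡ_)
open import Data.List.Relation.Unary.Unique.Propositional using (Unique)
open import Data.Product using (Σ; ∃; _×_; _,_; proj₁; proj₂)
open import Data.Sum using (_⊎_)
open import Data.Unit using (⊤)
open import Data.Bool using (Bool; true; false; _∧_; not; if_then_else_)
open import Relation.Nullary using (¬_; ⌊_⌋)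
open import Relation.Binary.PropositionalEquality using (_≡_; _≢_)

record Graph : Set where
  field
    n       : ℕ
    E       : ℕ
    ends    : Fin E → Fin n × Fin n
    loopless : ∀ e → proj₁ (ends e) ≢ proj₂ (ends e)

open Graph public

module _ (G : Graph) where

  Vtx : Set
  Vtx = Fin (n G)

  Edge : Set
  Edge = Fin (E G)

  Joins : Edge → Vtx → Vtx → Set
  Joins e u v = (ends G e ≡ (u , v)) ⊎ (ends G e ≡ (v , u))

  -- a walk is a start vertex u together with a list of steps (e , v):
  -- "traverse edge e, arriving at v".
  Steps : Set
  Steps = List (Edge × Vtx)

  ValidWalk : Vtx → Steps → Set
  ValidWalk u [] = ⊤
  ValidWalk u ((e , v) ∷ s) = Joins e u v × ValidWalk v s

  walkEnd : Vtx → Steps → Vtx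
  walkEnd u [] = u
  walkEnd u ((e , v) ∷ s) = walkEnd v s

  EdgesIn : (Edge → Set) → Steps → Set
  EdgesIn T [] = ⊤
  EdgesIn T ((e , v) ∷ s) = T e × EdgesIn T s

  IsTrail : Vtx → Steps → Set
  IsTrail u s = ValidWalk u s × Unique (map proj₁ s)

  IsClosedTrail : Vtx → Steps → Set
  IsClosedTrail u s = IsTrail u s × walkEnd u s ≡ u

  IsCycle : Vtx → Steps → Set
  IsCycle u s = IsClosedTrail u s × (0 < length s) × Unique (map proj₂ s)

  VSet : Set₁
  VSet = Vtx → Set

  IsSpanningTree : VSet → Subset (E G) → Set
  IsSpanningTree W T =
      (∀ e → e ∈ T → W (proj₁ (ends G e)) × W (proj₂ (ends G e)))
    × (∃ λ v → W v)
    × (∀ u v → W u → W v →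
         ∃ λ (s : Steps) → ValidWalk u s × EdgesIn (λ e → e ∈ T) s × walkEnd u s ≡ v)
    × (∀ u (s : Steps) → EdgesIn (λ e → e ∈ T) s → ¬ IsCycle u s)

  TreeConnected : ℕ → VSet → Set
  TreeConnected m W =
    Σ (Fin m → Subset (E G)) λ T →
        (∀ i → IsSpanningTree W (T i))
      × (∀ i j e → i ≢ j → e ∈ T i → e ∉ T j)

  _⊆ᵥ_ : VSet → VSet → Set
  W ⊆ᵥ W' = ∀ v → W v → W' v

  -- The partition of U (a vertex set; the graph considered is G[U]) into
  -- the vertex sets of the m-tree-connected components, given as k
  -- classes via a labelling c (labels 0..k-1 on vertices of U).

  class : Subset (n G) → (Vtx → ℕ) → ℕ → VSet
  class U c i v = (v ∈ U) × (c v ≡ i)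

  IsComponentPartition : ℕ → Subset (n G) → (k : ℕ) → (Vtx → ℕ) → Set₁
  IsComponentPartition m U k c =
      (∀ v → v ∈ U → c v < k)
    × (∀ i → i < k → ∃ λ v → class U c i v)
    × (∀ i → i < k → TreeConnected m (class U c i))
    × (∀ i → i < k → (W : VSet) → W ⊆ᵥ (λ v → v ∈ U) → class U c i ⊆ᵥ W →
         TreeConnected m W → W ⊆ᵥ class U c i)
    × ((W : VSet) → W ⊆ᵥ (λ v → v ∈ U) → TreeConnected m W →
         ((W' : VSet) → W' ⊆ᵥ (λ v → v ∈ U) → W ⊆ᵥ W' → TreeConnected m W' → W' ⊆ᵥ W) →
         ∃ λ i → (i < k) × (W ⊆ᵥ class U c i) × (class U c i ⊆ᵥ W))

  crossing : Subset (n G) → (Vtx → ℕ) → Edge → Bool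
  crossing U c e =
    ⌊ proj₁ (ends G e) ∈? U ⌋ ∧ ⌊ proj₂ (ends G e) ∈? U ⌋
      ∧ not ⌊ Data.Nat._≟_ (c (proj₁ (ends G e))) (c (proj₂ (ends G e))) ⌋

  crossingCount : Subset (n G) → (Vtx → ℕ) → ℕ
  crossingCount U c = length (filter (λ e → crossing U c e Data.Bool.≟ true) (allFin (E G)))

  -- Ω_m(G[U]) = m|P| - e(P), P the component partition (k classes, labelling c)
  Ω : ℕ → Subset (n G) → ℕ → (Vtx → ℕ) → ℤ
  Ω m U k c = + (m * k) ℤ.- + crossingCount U c

  -- for a closed trail v0 e1 v1 ... ek vk (vk = v0), the number of
  -- indices i ∈ {1..k} with v_i = v
  timesThrough : Steps → Vtx → ℕ
  timesThrough s v = length (filter (λ w → w ≟ v) (map proj₂ s))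

  IsSpanningClosedTrail : Vtx → Steps → Set
  IsSpanningClosedTrail u s = IsClosedTrail u s × (∀ v → v ∈ˡ (u ∷ map proj₂ s))

  HasSCT : (Vtx → ℕ) → Subset (n G) → Set
  HasSCT f S = ∃ λ u → ∃ λ (s : Steps) →
    IsSpanningClosedTrail u s × (∀ v → v ∈ S → timesThrough s v ≤ f v)

  Independent : Subset (n G) → Set
  Independent X = ∀ e → ¬ (proj₁ (ends G e) ∈ X × proj₂ (ends G e) ∈ X)

  -- Σ_{v ∈ S} (2 f(v) - 1)   (each term is ≥ 1 when f is positive on S)
  sumOver : Subset (n G) → (Vtx → ℕ) → ℕ
  sumOver S g = sum (map (λ v → if ⌊ v ∈? S ⌋ then g v else 0) (allFin (n G)))

  AllVertices : VSet
  AllVertices _ = ⊤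

{-# OPTIONS --safe #-}
module Submission where

-- A spanning closed trail is the same as a connected spanning subgraph with even degrees, so it
-- suffices to bound the degrees at v ∈ X by 2 f v + 1. Partition the edges into two disjoint
-- spanning trees, a set of held edges with at most deg v ∸ (2 f v + 1) of them at each v ∈ X, and
-- free edges, with as many held edges as possible. A free edge can be swapped for a suitable tree
-- edge, or for a held edge at a common vertex of X; let F be the set of edges that become free
-- after some sequence of swaps. Swaps do not enlarge the components of F ∩ Tᵢ, so both F ∩ T₁ and
-- F ∩ T₂ span each component of F, and by maximality every vertex of X met by F holds as many
-- edges as it may, all of them in F. Let S be the set of vertices v ∈ X of degree at least
-- 2 f v + 1 not met by F. Then T₁ ∪ T₂ ∪ F contains all edges avoiding S, and T₁ ∪ T₂ has degree at
-- most 2 f v + 1 on X \ S and at least 2 f v + 1 on S.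
--
-- If G has a spanning closed trail that is short on S, keep its edges between components of F, add
-- F ∩ T₁, and correct the parities by a join in F ∩ T₂. Otherwise Ω₂(G \ S) is bounded, and counting
-- the edges of T₁ ∪ T₂ shows that its degrees on S are exactly 2 f v + 1; so T₁ together with a join
-- in T₂ has small degrees on X.
--
-- Since the conclusion is decidable, the argument is carried out under double negation.

open import Defs
open import Data.Bool using (Bool; true; false; not; _∧_; _∨_; _xor_; if_then_else_)
import Data.Bool
open import Data.Bool.Properties using (∨-zeroʳ; xor-assoc; xor-comm; xor-same; xor-identityʳ)
open import Data.Empty using (⊥)
open import Data.Fin using (Fin; zero; suc; toℕ; fromℕ<)
open import Data.Fin.Patterns using (0F; 1F)
open import Data.Fin.Properties using (any?; all?; injective⇒≤; fromℕ<-injective; toℕ<n; toℕ-fromℕ<; toℕ-injective)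
  renaming (_≟_ to _≟ᶠ_)
open import Data.Fin.Subset using (Subset; _∈_; _⊆_; ∁)
open import Data.Fin.Subset.Properties using (_∈?_; x∈∁p⇒x∉p; x∉p⇒x∈∁p)
import Data.Integer as ℤ
import Data.Integer.Properties as ℤ
open import Data.List using (List; []; _∷_; _++_; map; length; filter; allFin; tabulate; lookup; deduplicate)
import Data.List.Membership.DecPropositional as DecMembership
open import Data.List.Membership.Propositional using () renaming (_∈_ to _∈ˡ_)
open import Data.List.Membership.Propositional.Properties
  using (∈-filter⁺; ∈-filter⁻; ∈-allFin; ∈-lookup; ∈-map⁺; ∈-map⁻; ∈-deduplicate⁺; ∈-deduplicate⁻; ∈-++⁻)
open import Data.List.Properties using (map-tabulate; length-tabulate; length-map; length-++; map-++; filter-all)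
open import Data.List.Relation.Unary.All using (All; []; _∷_)
import Data.List.Relation.Unary.All as All
import Data.List.Relation.Unary.All.Properties as All
open import Data.List.Relation.Unary.AllPairs using ([]; _∷_)
open import Data.List.Relation.Unary.Any using (here; there)
import Data.List.Relation.Unary.Unique.DecPropositional as DecUnique
import Data.List.Relation.Unary.Unique.DecPropositional.Properties as DecUnique
open import Data.List.Relation.Unary.Unique.Propositional using (Unique)
import Data.List.Relation.Unary.Unique.Propositional.Properties as Unique
open import Data.Nat using (ℕ; zero; suc; _+_; _*_; _∸_; _≤_; _<_; z≤n; s≤s; _≤?_; _<?_)
open import Data.Nat.Induction using (<-wellFounded)
open import Data.Nat.ListAction using (sum)
open import Data.Nat.Properties
open import Algebra.Properties.CommutativeMonoid.Sum +-0-commutativeMonoid using ()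
  renaming (sum to ∑; sum-cong-≗ to ∑-cong; ∑-distrib-+ to ∑-+; ∑-comm to ∑-swap)
open import Data.Nat.Solver using (module +-*-Solver)
open import Data.Product using (Σ; ∃; ∃₂; _×_; _,_; proj₁; proj₂)
open import Data.Product.Properties using () renaming (≡-dec to ×-≡-dec)
open import Data.Sum using (_⊎_; inj₁; inj₂; [_,_]′)
open import Data.Unit using (tt)
import Data.Vec as Vec
open import Data.Vec.Functional using (updateAt)
open import Data.Vec.Functional.Properties using (updateAt-updates; updateAt-minimal)
open import Data.Vec.Properties using (lookup∘tabulate; lookup⇒[]=; []=⇒lookup; ≡-dec; tabulate-cong)
open import Function using (_∘_; id; const)
open import Induction.WellFounded using (Acc; acc)
open import Level using (Level)
open import Relation.Binary using (DecidableEquality)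
open import Relation.Binary.PropositionalEquality
open import Relation.Nullary using (¬_; Dec; yes; no; does; ⌊_⌋; contradiction)
open import Relation.Nullary.Decidable
  using (map′; _×-dec_; _⊎-dec_; _→-dec_; decidable-stable; ¬?; ¬¬-excluded-middle; dec-true; dec-false)

-- The odd bound `2 f v + 1` costs nothing, because the degrees of the final edge set are even. It
-- also fits the count: the summand `2 f v - 1` in the doubled bound on Ω₂ plus 2 for a deleted
-- vertex gives the same number. Holding edges is a cautious way of deleting the surplus at `X`:
-- both spanning trees stay intact, and `S` collects the vertices where surplus may remain. Since
-- `X` is independent, an edge loads at most one vertex of `X`, so a swap of held edges at one
-- vertex disturbs no other. The freed set F is the flexible part of the graph. Any two vertices of
-- a component of F are joined in two edge-disjoint trees, one to be spent on connectivity and one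
-- on parity, so the course of a given trail inside a component may be forgotten. Outside F, an edge
-- lies in one of the two trees or meets `S`, and this rigidity is what makes the counting sharp.

private variable
  ℓ ℓ₁ ℓ₂ : Level
  A : Set ℓ₁
  B : Set ℓ₂
  m : ℕ

-- Reasoning under double negation, and extremal choices.

infixl 1 _>>=_

_>>=_ : ¬ ¬ A → (A → ¬ ¬ B) → ¬ ¬ B
(x >>= f) k = x (λ a → f a k)

return : A → ¬ ¬ A
return x k = k x

-- Induction over the finite index set; double negation does not pass through an arbitrary universal
-- quantifier.
all-¬¬ : {P : Fin m → Set ℓ} → (∀ i → ¬ ¬ P i) → ¬ ¬ (∀ i → P i)
all-¬¬ {zero}  h = return λ ()
all-¬¬ {suc m} h = do
  p₀ ← h zero
  p  ← all-¬¬ (h ∘ suc)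
  return λ { zero → p₀ ; (suc i) → p i }

-- Finitely many instances of excluded middle may be assumed under double negation. This turns
-- predicates without an evident decision procedure, such as being freed by some sequence of swaps,
-- into Boolean sets.
comprehension : (P : Fin m → Set ℓ) →
  ¬ ¬ Σ (Fin m → Bool) λ p → (∀ i → p i ≡ true → P i) × (∀ i → P i → p i ≡ true)
comprehension P = do
  P? ← all-¬¬ (λ i → ¬¬-excluded-middle {A = P i})
  return ( (λ i → does (P? i))
         , (λ i eq → sound (P? i) eq)
         , (λ i x → dec-true (P? i) x))
  where
  sound : {A : Set ℓ} (A? : Dec A) → does A? ≡ true → A
  sound (yes x) _ = x

-- Well-founded descent along `μ`, with excluded middle deciding at every stage whether a smaller
-- candidate exists.
minimiser : (P : A → Set ℓ) (μ : A → ℕ) → ∃ P →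
  ¬ ¬ (∃ λ x → P x × ∀ y → P y → μ x ≤ μ y)
minimiser {A = A} P μ (x₀ , Px₀) = go x₀ Px₀ (<-wellFounded (μ x₀))
  where
  go : ∀ x → P x → Acc _<_ (μ x) → ¬ ¬ (∃ λ x → P x × ∀ y → P y → μ x ≤ μ y)
  go x Px (acc rec) = do
    no ∄ ← ¬¬-excluded-middle {A = ∃ λ y → P y × μ y < μ x}
      where yes (y , Py , y<x) → go y Py (rec y<x)
    return (x , Px , λ y Py → ≮⇒≥ (λ y<x → ∄ (y , Py , y<x)))

maximiser : (P : A → Set ℓ) (μ : A → ℕ) (N : ℕ) → (∀ x → P x → μ x ≤ N) → ∃ P →
  ¬ ¬ (∃ λ x → P x × ∀ y → P y → μ y ≤ μ x)
maximiser P μ N bounded ∃P = do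
  x , Px , least ← minimiser P (λ x → N ∸ μ x) ∃P
  -- Since `μ y` is at most `N`, the subtraction is not truncated and can be cancelled.
  return (x , Px , λ y Py → ∸-cancelʳ-≤ (bounded y Py) (least y Py))


-- Finite sums, Boolean subsets and their cardinalities.

∑-mono : {f g : Fin m → ℕ} → (∀ i → f i ≤ g i) → ∑ f ≤ ∑ g
∑-mono {zero}  f≤g = z≤n
∑-mono {suc m} f≤g = +-mono-≤ (f≤g zero) (∑-mono (f≤g ∘ suc))

∑-mono-< : {f g : Fin m → ℕ} → (∀ i → f i ≤ g i) → ∀ i → f i < g i → ∑ f < ∑ g
∑-mono-< {suc m} f≤g zero    f<g = +-mono-<-≤ f<g (∑-mono (f≤g ∘ suc))
∑-mono-< {suc m} f≤g (suc i) f<g = +-mono-≤-< (f≤g zero) (∑-mono-< (f≤g ∘ suc) i f<g)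

∑-zero : {f : Fin m → ℕ} → (∀ i → f i ≡ 0) → ∑ f ≡ 0
∑-zero {zero}  f≡0 = refl
∑-zero {suc m} f≡0 = cong₂ _+_ (f≡0 zero) (∑-zero (f≡0 ∘ suc))

∑-one : ∀ m → ∑ {m} (λ _ → 1) ≡ m
∑-one zero    = refl
∑-one (suc m) = cong suc (∑-one m)

∑-*ˡ : (k : ℕ) (f : Fin m → ℕ) → ∑ (λ i → k * f i) ≡ k * ∑ f
∑-*ˡ {zero}  k f = sym (*-zeroʳ k)
∑-*ˡ {suc m} k f = trans (cong (k * f zero +_) (∑-*ˡ k (f ∘ suc))) (sym (*-distribˡ-+ k (f zero) _))

∑-+₃ : (f g h : Fin m → ℕ) → ∑ (λ i → f i + g i + h i) ≡ ∑ f + ∑ g + ∑ h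
∑-+₃ {m} f g h = trans (∑-+ {m} _ h) (cong (_+ ∑ h) (∑-+ f g))

term≤∑ : (f : Fin m → ℕ) (i : Fin m) → f i ≤ ∑ f
term≤∑ f zero    = m≤m+n _ _
term≤∑ f (suc i) = ≤-trans (term≤∑ (f ∘ suc) i) (m≤n+m _ (f zero))

∑-positive : (f : Fin m → ℕ) → 0 < ∑ f → ∃ λ i → 0 < f i
∑-positive {suc m} f pos with f zero in eq
... | suc k = zero , subst (0 <_) (sym eq) (s≤s z≤n)
... | zero  = let i , fi = ∑-positive (f ∘ suc) pos in suc i , fi

-- The two exceptional terms are added crosswise so that truncated subtraction never enters.
-- Deletions, insertions and changes of role are all computed from this form.
∑-differ : {f g : Fin m → ℕ} (i : Fin m) → (∀ j → j ≢ i → f j ≡ g j) → ∑ f + g i ≡ ∑ g + f i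
∑-differ {f = f} {g} zero f≡g = begin
  f zero + ∑ (f ∘ suc) + g zero   ≡⟨ +-comm (f zero + _) (g zero) ⟩
  g zero + (f zero + ∑ (f ∘ suc)) ≡⟨ cong (g zero +_) (+-comm (f zero) _) ⟩
  g zero + (∑ (f ∘ suc) + f zero) ≡⟨ cong (λ s → g zero + (s + f zero)) (∑-cong (λ j → f≡g (suc j) λ ())) ⟩
  g zero + (∑ (g ∘ suc) + f zero) ≡⟨ +-assoc (g zero) _ _ ⟨
  g zero + ∑ (g ∘ suc) + f zero   ∎
  where open ≡-Reasoning
∑-differ {f = f} {g} (suc i) f≡g = begin
  f zero + ∑ (f ∘ suc) + g (suc i)   ≡⟨ +-assoc (f zero) _ _ ⟩
  f zero + (∑ (f ∘ suc) + g (suc i)) ≡⟨ cong₂ _+_ (f≡g zero λ ()) (∑-differ i (λ j j≢i → f≡g (suc j) λ { refl → j≢i refl })) ⟩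
  g zero + (∑ (g ∘ suc) + f (suc i)) ≡⟨ +-assoc (g zero) _ _ ⟨
  g zero + ∑ (g ∘ suc) + f (suc i)   ∎
  where open ≡-Reasoning

∑-list : (f : Fin m → ℕ) → sum (map f (allFin m)) ≡ ∑ f
∑-list {m} f = trans (cong sum (map-tabulate id f)) (go f)
  where
  go : ∀ {m} (f : Fin m → ℕ) → sum (tabulate f) ≡ ∑ f
  go {zero}  f = refl
  go {suc m} f = cong (f zero +_) (go (f ∘ suc))

𝟙 : Bool → ℕ
𝟙 false = 0
𝟙 true  = 1

𝟙≤1 : ∀ x → 𝟙 x ≤ 1
𝟙≤1 false = z≤n
𝟙≤1 true  = ≤-refl

𝟙-mono : ∀ {x y} → (x ≡ true → y ≡ true) → 𝟙 x ≤ 𝟙 y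
𝟙-mono {false}     h = z≤n
𝟙-mono {true}  {y} h rewrite h refl = ≤-refl

length-filter : (p : A → Bool) (xs : List A) →
  length (filter (λ x → p x Data.Bool.≟ true) xs) ≡ sum (map (𝟙 ∘ p) xs)
length-filter p []       = refl
length-filter p (x ∷ xs) with p x
... | true  = cong suc (length-filter p xs)
... | false = length-filter p xs

sum-filter : (f : A → ℕ) (p : A → Bool) (xs : List A) →
  sum (map f (filter (λ x → p x Data.Bool.≟ true) xs)) ≡ sum (map (λ x → 𝟙 (p x) * f x) xs)
sum-filter f p []       = refl
sum-filter f p (x ∷ xs) with p x
... | true  = cong₂ _+_ (sym (+-identityʳ (f x))) (sum-filter f p xs)
... | false = sum-filter f p xs

card : (Fin m → Bool) → ℕ
card p = ∑ (𝟙 ∘ p)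

card≤ : (p : Fin m → Bool) → card p ≤ m
card≤ {m} p = subst (card p ≤_) (∑-one m) (∑-mono (λ i → 𝟙≤1 (p i)))

insert delete : (Fin m → Bool) → Fin m → Fin m → Bool
insert p i = updateAt p i (const true)
delete p i = updateAt p i (const false)

module _ (p : Fin m → Bool) (i : Fin m) where

  insert-here : insert p i i ≡ true
  insert-here = updateAt-updates i p

  delete-here : delete p i i ≡ false
  delete-here = updateAt-updates i p

  insert-there : ∀ {j} → j ≢ i → insert p i j ≡ p j
  insert-there {j} j≢i = updateAt-minimal j i p j≢i

  delete-there : ∀ {j} → j ≢ i → delete p i j ≡ p j
  delete-there {j} j≢i = updateAt-minimal j i p j≢i

  insert-⊇ : ∀ j → p j ≡ true → insert p i j ≡ true
  insert-⊇ j pj with j ≟ᶠ i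
  ... | yes refl = insert-here
  ... | no j≢i   = trans (insert-there j≢i) pj

  insert-inv : ∀ j → insert p i j ≡ true → j ≡ i ⊎ p j ≡ true
  insert-inv j eq with j ≟ᶠ i
  ... | yes j≡i = inj₁ j≡i
  ... | no j≢i  = inj₂ (trans (sym (insert-there j≢i)) eq)

  delete-inv : ∀ j → delete p i j ≡ true → j ≢ i × p j ≡ true
  delete-inv j eq with j ≟ᶠ i
  ... | yes refl = contradiction (trans (sym delete-here) eq) λ ()
  ... | no j≢i   = j≢i , trans (sym (delete-there j≢i)) eq

  ∑-delete : (w : Fin m → ℕ) → p i ≡ true →
    ∑ (λ j → 𝟙 (delete p i j) * w j) + w i ≡ ∑ (λ j → 𝟙 (p j) * w j)
  ∑-delete w pi = begin
    ∑ f + w i              ≡⟨ cong (∑ f +_) (trans (sym (*-identityˡ (w i))) (cong (λ x → 𝟙 x * w i) (sym pi))) ⟩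
    ∑ f + 𝟙 (p i) * w i    ≡⟨ ∑-differ i (λ j j≢i → cong (λ x → 𝟙 x * w j) (delete-there j≢i)) ⟩
    ∑ g + 𝟙 (delete p i i) * w i ≡⟨ cong (λ x → ∑ g + 𝟙 x * w i) delete-here ⟩
    ∑ g + 0                ≡⟨ +-identityʳ _ ⟩
    ∑ g                    ∎
    where
    open ≡-Reasoning
    f = λ j → 𝟙 (delete p i j) * w j
    g = λ j → 𝟙 (p j) * w j

  card-delete : p i ≡ true → suc (card (delete p i)) ≡ card p
  card-delete pi = begin
    suc (card (delete p i))                ≡⟨ +-comm 1 _ ⟩
    card (delete p i) + 1                  ≡⟨ cong (λ x → card (delete p i) + 𝟙 x) (sym pi) ⟩
    card (delete p i) + 𝟙 (p i)            ≡⟨ ∑-differ i (λ j j≢i → cong 𝟙 (delete-there j≢i)) ⟩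
    card p + 𝟙 (delete p i i)              ≡⟨ cong (λ x → card p + 𝟙 x) delete-here ⟩
    card p + 0                             ≡⟨ +-identityʳ _ ⟩
    card p                                 ∎
    where open ≡-Reasoning

  card-insert : p i ≡ false → card (insert p i) ≡ suc (card p)
  card-insert pi = begin
    card (insert p i)                      ≡⟨ +-identityʳ _ ⟨
    card (insert p i) + 0                  ≡⟨ cong (λ x → card (insert p i) + 𝟙 x) (sym pi) ⟩
    card (insert p i) + 𝟙 (p i)            ≡⟨ ∑-differ i (λ j j≢i → cong 𝟙 (insert-there j≢i)) ⟩
    card p + 𝟙 (insert p i i)              ≡⟨ cong (λ x → card p + 𝟙 x) insert-here ⟩
    card p + 1                             ≡⟨ +-comm _ 1 ⟩
    suc (card p)                           ∎
    where open ≡-Reasoning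

  card-insert≤ : card (insert p i) ≤ suc (card p)
  card-insert≤ with p i in eq
  ... | false = ≤-reflexive (card-insert eq)
  ... | true  = m≤n⇒m≤1+n (∑-mono (λ j → 𝟙-mono {insert p i j} (λ t → [ (λ { refl → eq }) , id ]′ (insert-inv j t))))

member : List (Fin m) → Fin m → Bool
member xs i = does (i ∈ˡ? xs)
  where open DecMembership _≟ᶠ_ using () renaming (_∈?_ to _∈ˡ?_)

module _ {m : ℕ} where
  open DecMembership (_≟ᶠ_ {m}) using () renaming (_∈?_ to _∈ˡ?_)

  member⁺ : ∀ {i} {xs : List (Fin m)} → i ∈ˡ xs → member xs i ≡ true
  member⁺ {i} {xs} i∈xs = dec-true (i ∈ˡ? xs) i∈xs

  member⁻ : ∀ {i} {xs : List (Fin m)} → member xs i ≡ true → i ∈ˡ xs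
  member⁻ {i} {xs} eq with i ∈ˡ? xs
  ... | yes i∈xs = i∈xs

  -- Without repetitions each element counts once. With `inc w` as the weight, this reads the
  -- degrees of a trail's edge set off the trail itself.
  sum-unique : (w : Fin m → ℕ) {xs : List (Fin m)} → Unique xs →
    ∑ (λ i → 𝟙 (member xs i) * w i) ≡ sum (map w xs)
  sum-unique w {[]} []        = ∑-zero {m} (λ _ → refl)
  sum-unique w {x ∷ xs} (x∉xs ∷ u) = begin
    ∑ f                       ≡⟨ +-identityʳ _ ⟨
    ∑ f + 0                   ≡⟨ cong (λ y → ∑ f + 𝟙 y * w x) (dec-false (x ∈ˡ? xs) (λ x∈ → All.lookup x∉xs x∈ refl)) ⟨
    ∑ f + g x                 ≡⟨ ∑-differ x (λ j j≢x → cong (λ y → 𝟙 y * w j) (same j j≢x)) ⟩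
    ∑ g + f x                 ≡⟨ cong (λ y → ∑ g + 𝟙 y * w x) (member⁺ {x} {x ∷ xs} (here refl)) ⟩
    ∑ g + (w x + 0)           ≡⟨ cong₂ _+_ (sum-unique w u) (+-identityʳ (w x)) ⟩
    sum (map w xs) + w x      ≡⟨ +-comm _ (w x) ⟩
    w x + sum (map w xs)      ∎
    where
    open ≡-Reasoning
    f = λ i → 𝟙 (member (x ∷ xs) i) * w i
    g = λ i → 𝟙 (member xs i) * w i
    same : ∀ j → j ≢ x → member (x ∷ xs) j ≡ member xs j
    same j j≢x = cong (_∨ member xs j) (dec-false (j ≟ᶠ x) j≢x)

  sum-unique≤ : (w : Fin m → ℕ) {xs : List (Fin m)} (p : Fin m → Bool) → Unique xs →
    (∀ {i} → i ∈ˡ xs → p i ≡ true) → sum (map w xs) ≤ ∑ (λ i → 𝟙 (p i) * w i)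
  sum-unique≤ w {xs} p u xs⊆p = subst (_≤ ∑ (λ i → 𝟙 (p i) * w i)) (sum-unique w u)
    (∑-mono (λ i → *-monoˡ-≤ (w i) (𝟙-mono {member xs i} (λ t → xs⊆p (member⁻ t)))))

  length-unique≤ : {xs : List (Fin m)} (p : Fin m → Bool) → Unique xs →
    (∀ {i} → i ∈ˡ xs → p i ≡ true) → length xs ≤ card p
  length-unique≤ {xs} p u xs⊆p = subst₂ _≤_ (len xs) (∑-cong (λ i → *-identityʳ (𝟙 (p i))))
    (sum-unique≤ (λ _ → 1) p u xs⊆p)
    where
    len : ∀ (xs : List (Fin m)) → sum (map (λ _ → 1) xs) ≡ length xs
    len []       = refl
    len (x ∷ xs) = cong suc (len xs)

infix 10 ⟪_⟫
⟪_⟫ : {A : Set} → (A → Bool) → A → Set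
⟪ p ⟫ x = p x ≡ true

lookup-injective : {A : Set} {xs : List A} → Unique xs → ∀ i j → lookup xs i ≡ lookup xs j → i ≡ j
lookup-injective (x∉ ∷ u) zero    zero    eq = refl
lookup-injective (x∉ ∷ u) zero    (suc j) eq = contradiction eq (All.lookup x∉ (∈-lookup j))
lookup-injective (x∉ ∷ u) (suc i) zero    eq = contradiction (sym eq) (All.lookup x∉ (∈-lookup i))
lookup-injective (x∉ ∷ u) (suc i) (suc j) eq = cong suc (lookup-injective u i j eq)

length-unique-<≤ : ∀ {k} {xs : List ℕ} → Unique xs → All (_< k) xs → length xs ≤ k
length-unique-<≤ {k} {xs} u xs<k = injective⇒≤ {f = code} λ {i} {j} eq →
  lookup-injective u i j (fromℕ<-injective _ _ (All.lookup xs<k (∈-lookup i)) (All.lookup xs<k (∈-lookup j)) eq)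
  where
  code : Fin (length xs) → Fin k
  code i = fromℕ< (All.lookup xs<k (∈-lookup i))

map-unique : {A B : Set} {f : A → B} (xs : List A) →
  (∀ {x y} → x ∈ˡ xs → y ∈ˡ xs → f x ≡ f y → x ≡ y) → Unique xs → Unique (map f xs)
map-unique []       inj []       = []
map-unique (x ∷ xs) inj (x∉ ∷ u) =
  All.map⁺ (All.tabulate λ y∈ eq → All.lookup x∉ y∈ (inj (here refl) (there y∈) eq))
  ∷ map-unique xs (λ x∈ y∈ → inj (there x∈) (there y∈)) u

-- Connectivity by edge sets, edge exchange, and counting components.

module Connectivity (G : Graph) where

  src tgt : Edge G → Vtx G
  src e = proj₁ (ends G e)
  tgt e = proj₂ (ends G e)

  data Conn (P : Edge G → Set) : Vtx G → Vtx G → Set where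
    done : ∀ {u} → Conn P u u
    step : ∀ {e u v w} → Joins G e u v → P e → Conn P v w → Conn P u w

  private variable
    P Q : Edge G → Set
    u v w : Vtx G

  Joins-sym : ∀ {e} → Joins G e u v → Joins G e v u
  Joins-sym (inj₁ eq) = inj₂ eq
  Joins-sym (inj₂ eq) = inj₁ eq

  conn-trans : Conn P u v → Conn P v w → Conn P u w
  conn-trans done         d = d
  conn-trans (step j p c) d = step j p (conn-trans c d)

  conn-sym : Conn P u v → Conn P v u
  conn-sym done         = done
  conn-sym (step j p c) = conn-trans (conn-sym c) (step (Joins-sym j) p done)

  conn-edge : ∀ {e} → P e → Conn P (src e) (tgt e)
  conn-edge p = step (inj₁ refl) p done

  at-ends : (R : Vtx G → Vtx G → Set) → (∀ {x y} → R x y → R y x) →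
    ∀ {e} → Joins G e u v → R (src e) (tgt e) → R u v
  at-ends R R-sym (inj₁ refl) r = r
  at-ends R R-sym (inj₂ refl) r = R-sym r

  at-ends⁻ : (R : Vtx G → Vtx G → Set) → (∀ {x y} → R x y → R y x) →
    ∀ {e} → Joins G e u v → R u v → R (src e) (tgt e)
  at-ends⁻ R R-sym (inj₁ refl) r = r
  at-ends⁻ R R-sym (inj₂ refl) r = R-sym r

  conn-bind : (∀ {e} → P e → Conn Q (src e) (tgt e)) → Conn P u v → Conn Q u v
  conn-bind h done         = done
  conn-bind h (step j p c) = conn-trans (at-ends (Conn _) conn-sym j (h p)) (conn-bind h c)

  conn-map : (∀ {e} → P e → Q e) → Conn P u v → Conn Q u v
  conn-map h = conn-bind (conn-edge ∘ h)

  conn-resp : (R : Vtx G → Set) → (∀ {e u v} → Joins G e u v → P e → R u → R v) →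
    Conn P u v → R u → R v
  conn-resp R h done         r = r
  conn-resp R h (step j p c) r = conn-resp R h c (h j p r)

  -- A path that starts inside `r` and ends outside has a step across the boundary. Such a step lets
  -- a tree or a closed trail grow.
  conn-leaves : (r : Vtx G → Bool) → Conn P u v → r u ≡ true → r v ≡ false →
    ∃ λ e → ∃₂ λ x y → Joins G e x y × P e × r x ≡ true × r y ≡ false
  conn-leaves r done ru rv = contradiction (trans (sym ru) rv) λ ()
  conn-leaves r (step {v = v} j p c) ru rw with r v in rv
  ... | true  = conn-leaves r c rv rw
  ... | false = _ , _ , _ , j , p , ru , rv

  -- Repeated passages through `f` collapse to at most one: two in the same direction are merged by
  -- skipping what lies between them, and two in opposite directions cancel altogether.
  conn-split : (f : Edge G) → Conn P u v →
    Conn (λ e → e ≢ f × P e) u v ⊎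
    ∃₂ λ x y → Joins G f x y × Conn (λ e → e ≢ f × P e) u x × Conn (λ e → e ≢ f × P e) y v
  conn-split f done = inj₁ done
  conn-split f (step {e} j p c) with e ≟ᶠ f | conn-split f c
  ... | no e≢f   | inj₁ c′                  = inj₁ (step j (e≢f , p) c′)
  ... | no e≢f   | inj₂ (x , y , j′ , c₁ , c₂) = inj₂ (x , y , j′ , step j (e≢f , p) c₁ , c₂)
  ... | yes refl | inj₁ c′                  = inj₂ (_ , _ , j , done , c′)
  ... | yes refl | inj₂ (x , y , j′ , c₁ , c₂) with j | j′
  ... | inj₁ refl | inj₁ refl = inj₂ (_ , _ , j′ , done , c₂)
  ... | inj₁ refl | inj₂ refl = inj₁ c₂
  ... | inj₂ refl | inj₁ refl = inj₁ c₂
  ... | inj₂ refl | inj₂ refl = inj₂ (_ , _ , j′ , done , c₂)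

  Connected : (Edge G → Set) → Set
  Connected P = ∀ u v → Conn P u v

  Exchange : (Edge G → Bool) → Edge G → Edge G → Edge G → Set
  Exchange p y z e = e ≡ z ⊎ (e ≢ y × p e ≡ true)

  -- A minimal subset of p that joins the ends of z consists of exchangeable edges.
  exchangeable-join : (p : Edge G → Bool) → Connected ⟪ p ⟫ → ∀ z →
    ¬ ¬ Conn (λ y → p y ≡ true × Connected (Exchange p y z)) (src z) (tgt z)
  exchangeable-join p p-conn z = do
    q , (q⊆p , q-conn) , least ← minimiser
      (λ q → (∀ e → q e ≡ true → p e ≡ true) × Conn ⟪ q ⟫ (src z) (tgt z)) card
      (p , (λ _ → id) , p-conn _ _)
    return (conn-map (λ {y} qy → q⊆p y qy , λ u v → conn-bind (reroute q q⊆p q-conn least y qy) (p-conn u v)) q-conn)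
    where
    reroute : ∀ q → (∀ e → q e ≡ true → p e ≡ true) → Conn ⟪ q ⟫ (src z) (tgt z) →
      (∀ q′ → (∀ e → q′ e ≡ true → p e ≡ true) × Conn ⟪ q′ ⟫ (src z) (tgt z) → card q ≤ card q′) →
      ∀ y → q y ≡ true → ∀ {e} → p e ≡ true → Conn (Exchange p y z) (src e) (tgt e)
    reroute q q⊆p q-conn least y qy {e} pe with e ≟ᶠ y
    ... | no e≢y = conn-edge (inj₂ (e≢y , pe))
    ... | yes refl with conn-split y q-conn
    ... | inj₁ shorter = contradiction
          (least (delete q y) ( (λ e d → q⊆p e (proj₂ (delete-inv q y e d)))
                              , conn-map (λ (e≢y , qe) → trans (delete-there q y e≢y) qe) shorter))
          (<⇒≱ (≤-reflexive (card-delete q y qy)))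
    -- The two pieces of the path on either side of `y`, closed up by `z`, form a detour between the
    -- ends of `y`.
    ... | inj₂ (x , x′ , j , c₁ , c₂) = at-ends⁻ (Conn _) conn-sym j
          (conn-trans (conn-sym (widen c₁)) (conn-trans (conn-edge (inj₁ refl)) (conn-sym (widen c₂))))
      where
      widen : ∀ {u v} → Conn (λ e → e ≢ y × q e ≡ true) u v → Conn (Exchange p y z) u v
      widen = conn-map (λ (e≢y , qe) → inj₂ (e≢y , q⊆p _ qe))

  -- Grown from `root`, each new vertex costs at most one new edge, so the edges stay fewer than the
  -- vertices reached. This bound stands in for acyclicity: it is what the final count uses, and a
  -- swap visibly preserves it.
  thin-spanning : (p : Edge G → Bool) → Connected ⟪ p ⟫ → Vtx G →
    ¬ ¬ Σ (Edge G → Bool) λ q →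
      (∀ e → q e ≡ true → p e ≡ true) × Connected ⟪ q ⟫ × card q < n G
  thin-spanning p p-conn root = do
    (q , r) , (q⊆p , root∈r , reach , q<r) , most ← maximiser Grown (λ (q , r) → card r) (n G)
      (λ (q , r) _ → card≤ r) (((λ _ → false) , insert (λ _ → false) root) , start)
    return ( q , q⊆p
           , (λ u v → conn-trans (conn-sym (reach u (full q r q⊆p root∈r reach q<r most u)))
                                 (reach v (full q r q⊆p root∈r reach q<r most v)))
           , <-≤-trans q<r (card≤ r))
    where
    Grown : (Edge G → Bool) × (Vtx G → Bool) → Set
    Grown (q , r) = (∀ e → q e ≡ true → p e ≡ true) × r root ≡ true
      × (∀ v → r v ≡ true → Conn ⟪ q ⟫ root v) × card q < card r

    start : Grown ((λ _ → false) , insert (λ _ → false) root)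
    start = (λ _ ()) , insert-here _ root
      , (λ v rv → [ (λ { refl → done }) , (λ ()) ]′ (insert-inv (λ _ → false) root v rv))
      , subst₂ _<_ (sym (∑-zero {E G} (λ _ → refl)))
          (sym (trans (card-insert (λ _ → false) root refl) (cong suc (∑-zero {n G} (λ _ → refl))))) (s≤s z≤n)

    full : ∀ q r → (∀ e → q e ≡ true → p e ≡ true) → r root ≡ true →
      (∀ v → r v ≡ true → Conn ⟪ q ⟫ root v) → card q < card r →
      (∀ qr → Grown qr → card (proj₂ qr) ≤ card r) → ∀ v → r v ≡ true
    full q r q⊆p root∈r reach q<r most v with r v in rv
    ... | true  = refl
    ... | false with conn-leaves r (p-conn root v) root∈r rv
    ... | e , x , y , j , pe , rx , ry = contradiction (most (insert q e , insert r y) grown)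
          (<⇒≱ (≤-reflexive (sym (card-insert r y ry))))
      where
      old : ∀ {u} → Conn ⟪ q ⟫ root u → Conn ⟪ insert q e ⟫ root u
      old = conn-map (λ {f} → insert-⊇ q e f)
      grown : Grown (insert q e , insert r y)
      grown = (λ f t → [ (λ { refl → pe }) , q⊆p f ]′ (insert-inv q e f t))
        , insert-⊇ r y root root∈r
        , (λ u t → [ (λ { refl → conn-trans (old (reach x rx)) (step j (insert-here q e) done) })
                   , (λ ru → old (reach u ru)) ]′ (insert-inv r y u t))
        , subst (card (insert q e) <_) (sym (card-insert r y ry)) (s≤s (≤-trans (card-insert≤ q e) q<r))

  private module _ (lab : Vtx G → Vtx G) (a b : Vtx G) where

    relabel : Vtx G → Vtx G
    relabel x = if does (x ≟ᶠ a) then b else x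

    kept : List (Vtx G) → List (Vtx G)
    kept = filter (λ r → ¬? (lab r ≟ᶠ a))

    relabel-≢ : ∀ {x} → x ≢ a → relabel x ≡ x
    relabel-≢ {x} x≢a rewrite dec-false (x ≟ᶠ a) x≢a = refl

    relabel-a : relabel a ≡ b
    relabel-a rewrite dec-true (a ≟ᶠ a) refl = refl

    relabel-b : relabel b ≡ b
    relabel-b with b ≟ᶠ a
    ... | yes _ = refl
    ... | no _  = refl

    -- The labels on `R` are distinct, so at most one representative has label `a` and is dropped.
    kept-length : ∀ {R} → Unique (map lab R) → length R ≤ suc (length (kept R))
    kept-length {[]} _ = z≤n
    kept-length {r ∷ R} (r∉ ∷ uR) with lab r ≟ᶠ a
    ... | no _     = s≤s (kept-length uR)
    ... | yes refl = s≤s (≤-reflexive (cong length (sym (filter-all (λ r → ¬? (lab r ≟ᶠ a))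
                       (All.map (_∘ sym) (All.map⁻ r∉))))))

    -- Merging `a` into `b` could create a collision only through a representative labelled `a`, and
    -- none is kept.
    kept-unique : ∀ {R} → Unique (map lab R) → Unique (map (relabel ∘ lab) (kept R))
    kept-unique {[]} _ = []
    kept-unique {r ∷ R} (r∉ ∷ uR) with lab r ≟ᶠ a
    ... | yes _  = kept-unique uR
    ... | no r≢a = All.map⁺ (All.tabulate λ {x} x∈ eq →
                     let x∈R , x≢a = ∈-filter⁻ (λ r → ¬? (lab r ≟ᶠ a)) {xs = R} x∈ in
                     All.lookup (All.map⁻ r∉) x∈R
                       (trans (sym (relabel-≢ r≢a)) (trans eq (relabel-≢ x≢a))))
                   ∷ kept-unique uR

  -- R is a set of vertices in pairwise distinct components of the graph with edge list es.
  labelling : (es : List (Edge G)) → ∃₂ λ (lab : Vtx G → Vtx G) (R : List (Vtx G)) →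
    (∀ {e} → e ∈ˡ es → lab (src e) ≡ lab (tgt e)) × Unique (map lab R) × n G ≤ length R + length es
  labelling [] = id , allFin _ , (λ ()) , Unique.map⁺ id (Unique.allFin⁺ _)
    , ≤-reflexive (sym (trans (+-identityʳ _) (length-tabulate id)))
  labelling (e ∷ es) = let lab , R , same , uR , n≤ = labelling es in
    let a = lab (src e) ; b = lab (tgt e) in
    relabel lab a b ∘ lab , kept lab a b R
    , (λ { (here refl) → trans (relabel-a lab a b) (sym (relabel-b lab a b))
         ; (there e∈) → cong (relabel lab a b) (same e∈) })
    , kept-unique lab a b uR
    , ≤-trans n≤ (≤-trans (+-monoˡ-≤ (length es) (kept-length lab a b uR))
                          (≤-reflexive (sym (+-suc _ _))))

  conn-label : {es : List (Edge G)} {lab : Vtx G → Vtx G} →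
    (∀ {e} → e ∈ˡ es → lab (src e) ≡ lab (tgt e)) → Conn (_∈ˡ es) u v → lab u ≡ lab v
  conn-label same done = refl
  conn-label {lab = lab} same (step j e∈ c) =
    trans (at-ends (λ x y → lab x ≡ lab y) sym j (same e∈)) (conn-label same c)

  -- Each edge lowers the number of components by at most one, so at least `n G` minus `card p`
  -- vertices can be chosen from distinct components. Those outside `s` have distinct values under
  -- `c`, because equal values are joined by `p`; the others lie in `s`.
  n≤edges+classes : (p : Edge G → Bool) (s : Vtx G → Bool) (k : ℕ) (c : Vtx G → ℕ) →
    (∀ v → s v ≡ false → c v < k) →
    (∀ u v → s u ≡ false → s v ≡ false → c u ≡ c v → Conn ⟪ p ⟫ u v) →
    n G ≤ card p + (k + card s)
  n≤edges+classes p s k c c<k joined = begin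
    n G                                       ≤⟨ n≤ ⟩
    length R + length es                      ≡⟨ +-comm _ (length es) ⟩
    length es + length R                      ≡⟨ cong₂ _+_ (trans (length-filter p (allFin _)) (∑-list (𝟙 ∘ p))) (split R) ⟩
    card p + (length (map c R₀) + length R₁)  ≤⟨ +-monoʳ-≤ (card p) (+-mono-≤ R₀≤ R₁≤) ⟩
    card p + (k + card s)                     ∎
    where
    open ≤-Reasoning
    es = filter (λ e → p e Data.Bool.≟ true) (allFin (E G))
    labels = labelling es
    lab = proj₁ labels
    R = proj₁ (proj₂ labels)
    same = proj₁ (proj₂ (proj₂ labels))
    uR = proj₁ (proj₂ (proj₂ (proj₂ labels)))
    n≤ = proj₂ (proj₂ (proj₂ (proj₂ labels)))
    R₀ = filter (λ v → s v Data.Bool.≟ false) R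
    R₁ = filter (λ v → s v Data.Bool.≟ true) R

    split : ∀ R → length R ≡ length (map c (filter (λ v → s v Data.Bool.≟ false) R))
                           + length (filter (λ v → s v Data.Bool.≟ true) R)
    split [] = refl
    split (r ∷ R) with s r
    ... | false = cong suc (split R)
    ... | true  = trans (cong suc (split R)) (sym (+-suc _ _))

    R₁≤ : length R₁ ≤ card s
    R₁≤ = length-unique≤ s (Unique.filter⁺ (λ v → s v Data.Bool.≟ true) (Unique.map⁻ uR))
      (λ v∈ → proj₂ (∈-filter⁻ (λ v → s v Data.Bool.≟ true) {xs = R} v∈))

    lab-injective : ∀ {R} → Unique (map lab R) → ∀ {x y} → x ∈ˡ R → y ∈ˡ R → lab x ≡ lab y → x ≡ y
    lab-injective (r∉ ∷ u) (here refl) (here refl) eq = refl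
    lab-injective (r∉ ∷ u) (here refl) (there y∈) eq = contradiction eq (All.lookup (All.map⁻ r∉) y∈)
    lab-injective (r∉ ∷ u) (there x∈) (here refl) eq = contradiction (sym eq) (All.lookup (All.map⁻ r∉) x∈)
    lab-injective (r∉ ∷ u) (there x∈) (there y∈) eq = lab-injective u x∈ y∈ eq

    distinct : ∀ {x y} → x ∈ˡ R₀ → y ∈ˡ R₀ → c x ≡ c y → x ≡ y
    distinct x∈ y∈ eq =
      let x∈R , sx = ∈-filter⁻ (λ v → s v Data.Bool.≟ false) {xs = R} x∈
          y∈R , sy = ∈-filter⁻ (λ v → s v Data.Bool.≟ false) {xs = R} y∈
      in lab-injective uR x∈R y∈R (conn-label {es = es} same
           (conn-map (λ {e} pe → ∈-filter⁺ (λ e → p e Data.Bool.≟ true) (∈-allFin e) pe) (joined _ _ sx sy eq)))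

    R₀≤ : length (map c R₀) ≤ k
    R₀≤ = length-unique-<≤ (map-unique R₀ distinct (Unique.filter⁺ (λ v → s v Data.Bool.≟ false) (Unique.map⁻ uR)))
      (All.map⁺ (All.tabulate λ {v} v∈ → c<k v (proj₂ (∈-filter⁻ (λ v → s v Data.Bool.≟ false) {xs = R} v∈))))

-- Tree packings and the partition into tree-connected components.

∈-lookup⁺ : ∀ {m} {X : Subset m} {i} → Vec.lookup X i ≡ true → i ∈ X
∈-lookup⁺ {X = X} {i} = lookup⇒[]= i X

∈-lookup⁻ : ∀ {m} {X : Subset m} {i} → i ∈ X → Vec.lookup X i ≡ true
∈-lookup⁻ = []=⇒lookup

∈-tabulate⁺ : ∀ {m} {p : Fin m → Bool} {i} → p i ≡ true → i ∈ Vec.tabulate p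
∈-tabulate⁺ {p = p} {i} pi = ∈-lookup⁺ (trans (lookup∘tabulate p i) pi)

∈-tabulate⁻ : ∀ {m} {p : Fin m → Bool} {i} → i ∈ Vec.tabulate p → p i ≡ true
∈-tabulate⁻ {p = p} {i} i∈ = trans (sym (lookup∘tabulate p i)) (∈-lookup⁻ i∈)

module IndexOf {A : Set} (_≟_ : DecidableEquality A) where

  indexOf : List A → A → ℕ
  indexOf []       x = 0
  indexOf (y ∷ ys) x with x ≟ y
  ... | yes _ = 0
  ... | no _  = suc (indexOf ys x)

  indexOf-< : ∀ {xs x} → x ∈ˡ xs → indexOf xs x < length xs
  indexOf-< {y ∷ ys} {x} x∈ with x ≟ y
  indexOf-< {y ∷ ys} x∈          | yes _  = s≤s z≤n
  indexOf-< {y ∷ ys} (here x≡y)  | no x≢y = contradiction x≡y x≢y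
  indexOf-< {y ∷ ys} (there x∈)  | no _   = s≤s (indexOf-< x∈)

  indexOf-injective : ∀ {xs x y} → x ∈ˡ xs → y ∈ˡ xs → indexOf xs x ≡ indexOf xs y → x ≡ y
  indexOf-injective {z ∷ zs} {x} {y} x∈ y∈ eq with x ≟ z | y ≟ z
  indexOf-injective x∈ y∈ eq | yes refl | yes refl = refl
  indexOf-injective (here x≡z) y∈ eq | no x≢z | _ = contradiction x≡z x≢z
  indexOf-injective x∈ (here y≡z) eq | _ | no y≢z = contradiction y≡z y≢z
  indexOf-injective (there x∈) (there y∈) eq | no _ | no _ = indexOf-injective x∈ y∈ (suc-injective eq)

  indexOf-surjective : ∀ {xs} → Unique xs → ∀ {i} → i < length xs → ∃ λ x → x ∈ˡ xs × indexOf xs x ≡ i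
  indexOf-surjective {y ∷ ys} (y∉ ∷ u) {zero} _ = y , here refl , first
    where
    first : indexOf (y ∷ ys) y ≡ 0
    first with y ≟ y
    ... | yes _  = refl
    ... | no y≢y = contradiction refl y≢y
  indexOf-surjective {y ∷ ys} (y∉ ∷ u) {suc i} (s≤s i<) with indexOf-surjective u i<
  ... | x , x∈ , eq = x , there x∈ , later
    where
    later : indexOf (y ∷ ys) x ≡ suc i
    later with x ≟ y
    ... | yes refl = contradiction refl (All.lookup y∉ x∈)
    ... | no _     = cong suc eq

∨-elim : ∀ x {y} → x ∨ y ≡ true → x ≡ true ⊎ y ≡ true
∨-elim true  _  = inj₁ refl
∨-elim false eq = inj₂ eq

∨-introʳ : ∀ x {y} → y ≡ true → x ∨ y ≡ true
∨-introʳ x refl = ∨-zeroʳ x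

∨-introˡ : ∀ {x} y → x ≡ true → x ∨ y ≡ true
∨-introˡ y refl = refl

∨-∧-not-elim : ∀ x y z → x ∨ (y ∧ not z) ≡ true → x ≡ true ⊎ (y ≡ true × z ≡ false)
∨-∧-not-elim true  _    _     _ = inj₁ refl
∨-∧-not-elim false true false _ = inj₂ (refl , refl)

module Packing (G : Graph) where
  open Connectivity G

  walk⇒conn : ∀ {P : Edge G → Set} {u} s → ValidWalk G u s → EdgesIn G P s → Conn P u (walkEnd G u s)
  walk⇒conn []            _        _         = done
  walk⇒conn ((e , v) ∷ s) (j , js) (pe , ps) = step j pe (walk⇒conn s js ps)

  conn⇒walk : ∀ {P : Edge G → Set} {u v} → Conn P u v →
    ∃ λ s → ValidWalk G u s × EdgesIn G P s × walkEnd G u s ≡ v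
  conn⇒walk done = [] , tt , tt , refl
  conn⇒walk (step {e} {v = v} j pe c) =
    let s , js , ps , eq = conn⇒walk c in (e , v) ∷ s , (j , js) , (pe , ps) , eq

  edgesIn-map : ∀ {P Q : Edge G → Set} s → (∀ {e} → e ∈ˡ map proj₁ s → P e → Q e) → EdgesIn G P s → EdgesIn G Q s
  edgesIn-map []      h _        = tt
  edgesIn-map (_ ∷ s) h (p , ps) = h (here refl) p , edgesIn-map s (h ∘ there) ps

  -- `TreeConnected` relaxed from trees to connected edge sets. In this form unions are easy to
  -- build, and `packed⇒tree` recovers trees by thinning.
  Packed : ℕ → VSet G → Set
  Packed m W = (∃ λ v → W v) × Σ (Fin m → Edge G → Bool) λ B →
      (∀ i e → B i e ≡ true → W (src e) × W (tgt e))
    × (∀ i u v → W u → W v → Conn ⟪ B i ⟫ u v)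
    × (∀ i j e → i ≢ j → B i e ≡ true → B j e ≢ true)

  module _ {m : ℕ} {W : VSet G} where

    tree⇒packed : Fin m → TreeConnected G m W → Packed m W
    tree⇒packed i₀ (T , tree , disjoint) =
        proj₁ (proj₂ (tree i₀))
      , (λ i e → Vec.lookup (T i) e)
      , (λ i e t → proj₁ (tree i) e (∈-lookup⁺ t))
      , (λ i u v wu wv → let s , js , ps , eq = proj₁ (proj₂ (proj₂ (tree i))) u v wu wv in
           subst (Conn _ u) eq (walk⇒conn s js (edgesIn-map s (λ _ → ∈-lookup⁻) ps)))
      , (λ i j e i≢j t t′ → disjoint i j e i≢j (∈-lookup⁺ t) (∈-lookup⁺ t′))

    -- A minimal connected subset is acyclic, since an edge on a cycle could be bypassed along the
    -- rest of that cycle.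
    spanning-tree : (p : Edge G → Bool) → (∃ λ v → W v) → (∀ e → p e ≡ true → W (src e) × W (tgt e)) →
      (∀ u v → W u → W v → Conn ⟪ p ⟫ u v) →
      ¬ ¬ Σ (Edge G → Bool) λ q → (∀ e → q e ≡ true → p e ≡ true) × IsSpanningTree G W (Vec.tabulate q)
    spanning-tree p ∃W p⊆W p-conn = do
      q , (q⊆p , q-conn) , least ← minimiser
        (λ q → (∀ e → q e ≡ true → p e ≡ true) × (∀ u v → W u → W v → Conn ⟪ q ⟫ u v)) card
        (p , (λ _ → id) , p-conn)
      return ( q , q⊆p
             , (λ e e∈ → p⊆W e (q⊆p e (∈-tabulate⁻ e∈)))
             , ∃W
             , (λ u v wu wv → let s , js , ps , eq = conn⇒walk (q-conn u v wu wv) in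
                  s , js , edgesIn-map s (λ _ → ∈-tabulate⁺) ps , eq)
             , acyclic q q⊆p q-conn least)
      where
      acyclic : ∀ q → (∀ e → q e ≡ true → p e ≡ true) → (∀ u v → W u → W v → Conn ⟪ q ⟫ u v) →
        (∀ q′ → (∀ e → q′ e ≡ true → p e ≡ true) × (∀ u v → W u → W v → Conn ⟪ q′ ⟫ u v) → card q ≤ card q′) →
        ∀ u s → EdgesIn G (_∈ Vec.tabulate q) s → ¬ IsCycle G u s
      acyclic q q⊆p q-conn least u ((e , v) ∷ s) (e∈ , s∈) ((((j , js) , e∉ ∷ _) , eq) , _ , _) =
        <⇒≱ (≤-reflexive (card-delete q e (∈-tabulate⁻ e∈)))
            (least (delete q e) ( (λ f d → q⊆p f (proj₂ (delete-inv q e f d)))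
                                , λ x y wx wy → conn-bind detour (q-conn x y wx wy)))
        where
        around : Conn ⟪ delete q e ⟫ v u
        around = subst (Conn _ v) eq (walk⇒conn s js (edgesIn-map s
          (λ f∈ qf → trans (delete-there q e (All.lookup e∉ f∈ ∘ sym)) (∈-tabulate⁻ qf)) s∈))
        detour : ∀ {f} → q f ≡ true → Conn ⟪ delete q e ⟫ (src f) (tgt f)
        detour {f} qf with f ≟ᶠ e
        ... | yes refl = at-ends⁻ (Conn _) conn-sym j (conn-sym around)
        ... | no f≢e   = conn-edge (trans (delete-there q e f≢e) qf)

    packed⇒tree : Packed m W → ¬ ¬ TreeConnected G m W
    packed⇒tree (∃W , B , B⊆W , B-conn , disjoint) = do
      trees ← all-¬¬ (λ i → spanning-tree (B i) ∃W (B⊆W i) (B-conn i))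
      return ( (λ i → Vec.tabulate (proj₁ (trees i)))
             , (λ i → proj₂ (proj₂ (trees i)))
             , (λ i j e i≢j e∈i e∈j → disjoint i j e i≢j
                  (proj₁ (proj₂ (trees i)) e (∈-tabulate⁻ e∈i))
                  (proj₁ (proj₂ (trees j)) e (∈-tabulate⁻ e∈j))))

    tree-resp : ∀ {W′} → (∀ v → W v → W′ v) → (∀ v → W′ v → W v) → TreeConnected G m W → TreeConnected G m W′
    tree-resp to from (T , tree , disjoint) = T , (λ i → let inW , (v , wv) , conn , acyclic = tree i in
        (λ e e∈ → let a , b = inW e e∈ in to _ a , to _ b)
      , (v , to v wv)
      , (λ u v wu wv → conn u v (from u wu) (from v wv))
      , acyclic) , disjoint

    packed-resp : ∀ {W′} → (∀ v → W v → W′ v) → (∀ v → W′ v → W v) → Packed m W → Packed m W′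
    packed-resp to from ((v , wv) , B , B⊆W , B-conn , disjoint) =
      (v , to v wv) , B , (λ i e t → let a , b = B⊆W i e t in to _ a , to _ b)
      , (λ i u v wu wv → B-conn i u v (from u wu) (from v wv)) , disjoint

  -- An edge of `B′` with both ends in `w` might already belong to some `B j`. Such edges are left
  -- out and replaced by paths in `B i`, which keeps the new sets disjoint.
  packed-∪ : ∀ {m} {w w′ : Vtx G → Bool} {x} → w x ≡ true → w′ x ≡ true →
    Packed m ⟪ w ⟫ → Packed m ⟪ w′ ⟫ → Packed m ⟪ (λ v → w v ∨ w′ v) ⟫
  packed-∪ {m} {w} {w′} {x} wx w′x (_ , B , B⊆w , B-conn , disjoint) (_ , B′ , B′⊆w′ , B′-conn , disjoint′) =
    (x , ∨-introˡ (w′ x) wx) , C , C⊆ , (λ i u v wu wv → conn-trans (to-x i u wu) (conn-sym (to-x i v wv))) , C-disjoint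
    where
    C : Fin m → Edge G → Bool
    C i e = B i e ∨ (B′ i e ∧ not (w (src e) ∧ w (tgt e)))

    C-inv : ∀ i e → C i e ≡ true → B i e ≡ true ⊎ (B′ i e ≡ true × w (src e) ∧ w (tgt e) ≡ false)
    C-inv i e = ∨-∧-not-elim (B i e) (B′ i e) (w (src e) ∧ w (tgt e))

    C⊆ : ∀ i e → C i e ≡ true → w (src e) ∨ w′ (src e) ≡ true × w (tgt e) ∨ w′ (tgt e) ≡ true
    C⊆ i e t with C-inv i e t
    ... | inj₁ b       = let s , t = B⊆w i e b in ∨-introˡ _ s , ∨-introˡ _ t
    ... | inj₂ (b , _) = let s , t = B′⊆w′ i e b in ∨-introʳ (w (src e)) s , ∨-introʳ (w (tgt e)) t

    C-edge : ∀ i {e} → B′ i e ≡ true → Conn ⟪ C i ⟫ (src e) (tgt e)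
    C-edge i {e} b with w (src e) in ws | w (tgt e) in wt
    ... | true | true = conn-map (∨-introˡ _) (B-conn i _ _ ws wt)
    ... | true | false = conn-edge (∨-introʳ (B i e) (cong₂ _∧_ b (cong not (cong₂ _∧_ ws wt))))
    ... | false | _ = conn-edge (∨-introʳ (B i e) (cong₂ _∧_ b (cong not (cong₂ _∧_ ws refl))))

    to-x : ∀ i u → w u ∨ w′ u ≡ true → Conn ⟪ C i ⟫ u x
    to-x i u wu with ∨-elim (w u) wu
    ... | inj₁ t = conn-map (∨-introˡ _) (B-conn i u x t wx)
    ... | inj₂ t = conn-bind (C-edge i) (B′-conn i u x t w′x)

    both : ∀ i e → B i e ≡ true → w (src e) ∧ w (tgt e) ≡ true
    both i e b = let s , t = B⊆w i e b in cong₂ _∧_ s t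

    C-disjoint : ∀ i j e → i ≢ j → C i e ≡ true → C j e ≢ true
    C-disjoint i j e i≢j ci cj with C-inv i e ci | C-inv j e cj
    ... | inj₁ b       | inj₁ b′       = disjoint i j e i≢j b b′
    ... | inj₁ b       | inj₂ (_ , f)  = contradiction (trans (sym (both i e b)) f) λ ()
    ... | inj₂ (_ , f) | inj₁ b        = contradiction (trans (sym (both j e b)) f) λ ()
    ... | inj₂ (b , _) | inj₂ (b′ , _) = disjoint′ i j e i≢j b b′

  module Components (m : ℕ) (U : Subset (n G)) where

    -- The last clause is stronger than maximality under inclusion: every packed set that merely
    -- meets `w` is absorbed by it. This is what makes blocks equal or disjoint.
    Block : Vtx G → (Vtx G → Bool) → Set
    Block x w = w x ≡ true × (∀ v → w v ≡ true → v ∈ U) × TreeConnected G (suc m) ⟪ w ⟫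
      × (∀ w′ → (∀ v → w′ v ≡ true → v ∈ U) → Packed (suc m) ⟪ w′ ⟫ →
         ∀ {y} → w y ≡ true → w′ y ≡ true → ∀ v → w′ v ≡ true → w v ≡ true)

    -- Choose a packed set around `x` of largest cardinality. Its union with a packed set that meets
    -- it is packed again, hence no larger.
    block : ∀ x → x ∈ U → ¬ ¬ ∃ (Block x)
    block x x∈U = do
      w , (wx , w⊆U , w-packed) , most ← maximiser
        (λ w → w x ≡ true × (∀ v → w v ≡ true → v ∈ U) × Packed (suc m) ⟪ w ⟫) card (n G) (λ w _ → card≤ w)
        (only , insert-here _ x
          , (λ v t → [ (λ { refl → x∈U }) , (λ ()) ]′ (insert-inv (λ _ → false) x v t))
          , (x , insert-here _ x) , (λ _ _ → false) , (λ _ _ ())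
          , (λ i u v u∈ v∈ → single u∈ v∈) , λ _ _ _ _ ())
      w-trees ← packed⇒tree w-packed
      return (w , wx , w⊆U , w-trees , λ w′ w′⊆U w′-packed {y} wy w′y v w′v →
        absorbed w most v w′ w′v
          (∨-introˡ _ wx)
          (λ u t → [ w⊆U u , w′⊆U u ]′ (∨-elim (w u) t))
          (packed-∪ wy w′y w-packed w′-packed))
      where
      only : Vtx G → Bool
      only = insert (λ _ → false) x
      single : ∀ {P u v} → only u ≡ true → only v ≡ true → Conn P u v
      single {u = u} {v} u∈ v∈ with insert-inv (λ _ → false) x u u∈ | insert-inv (λ _ → false) x v v∈
      ... | inj₁ refl | inj₁ refl = done
      absorbed : ∀ w → (∀ w′ → w′ x ≡ true × (∀ v → w′ v ≡ true → v ∈ U) × Packed (suc m) ⟪ w′ ⟫ → card w′ ≤ card w) →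
        ∀ v w′ → w′ v ≡ true →
        w x ∨ w′ x ≡ true → (∀ v → w v ∨ w′ v ≡ true → v ∈ U) → Packed (suc m) ⟪ (λ v → w v ∨ w′ v) ⟫ →
        w v ≡ true
      absorbed w most v w′ w′v x∈ ⊆U packed with w v in wv
      ... | true  = refl
      ... | false = contradiction (most _ (x∈ , ⊆U , packed)) (<⇒≱ (∑-mono-<
        (λ u → 𝟙-mono {w u} (∨-introˡ _)) v
        (subst₂ (λ a b → 𝟙 a < 𝟙 b) (sym wv) (sym (∨-introʳ (w v) w′v)) (s≤s z≤n))))

    -- Every vertex set spanned by m + 1 edge-disjoint trees lies in one class; this is recorded
    -- besides IsComponentPartition, where only maximal such sets are compared with the classes.
    component-partition : ¬ ¬ ∃₂ λ k c → IsComponentPartition G (suc m) U k c ×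
      (∀ W → (∀ v → W v → v ∈ U) → Packed (suc m) W → ∀ {x y} → W x → W y → c x ≡ c y)
    component-partition = do
      blocks ← all-¬¬ (λ v → total v)
      return (Partition.result (proj₁ ∘ blocks) (proj₂ ∘ blocks))
      where
      -- An empty default outside `U` allows the blocks of all vertices to be chosen at once by
      -- `all-¬¬`.
      total : ∀ v → ¬ ¬ (∃ λ w → v ∈ U → Block v w)
      total v = do
        yes v∈U ← ¬¬-excluded-middle {A = v ∈ U}
          where no v∉U → return ((λ _ → false) , λ v∈U → contradiction v∈U v∉U)
        w , b ← block v v∈U
        return (w , λ _ → b)

      module Partition (w : Vtx G → Vtx G → Bool) (w-block : ∀ v → v ∈ U → Block v (w v)) where

        _≟ˢ_ : DecidableEquality (Subset (n G))
        _≟ˢ_ = ≡-dec Data.Bool._≟_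
        open IndexOf _≟ˢ_

        -- Boolean functions have no decidable equality, whereas vectors do; listing the distinct
        -- codes then numbers the blocks consecutively.
        code : Vtx G → Subset (n G)
        code = Vec.tabulate ∘ w

        inU? : ∀ v → Dec (Vec.lookup U v ≡ true)
        inU? v = Vec.lookup U v Data.Bool.≟ true

        codes : List (Subset (n G))
        codes = deduplicate _≟ˢ_ (map code (filter inU? (allFin _)))

        code∈ : ∀ {v} → v ∈ U → code v ∈ˡ codes
        code∈ {v} v∈U = ∈-deduplicate⁺ _≟ˢ_ (∈-map⁺ code (∈-filter⁺ inU? (∈-allFin v) (∈-lookup⁻ v∈U)))

        k : ℕ
        k = length codes

        c : Vtx G → ℕ
        c = indexOf codes ∘ code

        onto : ∀ i → i < k → ∃ λ v → v ∈ U × c v ≡ i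
        onto i i<k =
          let x , x∈ , eq = indexOf-surjective (DecUnique.deduplicate-! _≟ˢ_ (map code (filter inU? (allFin _)))) i<k
              v , v∈ , x≡ = ∈-map⁻ code (∈-deduplicate⁻ _≟ˢ_ (map code (filter inU? (allFin _))) x∈)
          in v , ∈-lookup⁺ (proj₂ (∈-filter⁻ inU? {xs = allFin _} v∈)) , trans (cong (indexOf codes) (sym x≡)) eq

        block-packed : ∀ {v} → v ∈ U → Packed (suc m) ⟪ w v ⟫
        block-packed v∈U = tree⇒packed zero (proj₁ (proj₂ (proj₂ (w-block _ v∈U))))

        -- Each of the two blocks meets the other and therefore contains it.
        coincide : ∀ {x y} → x ∈ U → y ∈ U → w x y ≡ true → ∀ v → w x v ≡ w y v
        coincide {x} {y} x∈U y∈U wxy v with w-block x x∈U | w-block y y∈U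
        ... | wx , wx⊆U , _ , wx-max | wy , wy⊆U , _ , wy-max
          with w x v in eq | w y v in eq′
        ... | true  | true  = refl
        ... | false | false = refl
        ... | true  | false = trans (sym (wy-max (w x) wx⊆U (block-packed x∈U) wy wxy v eq)) eq′
        ... | false | true  = trans (sym eq) (wx-max (w y) wy⊆U (block-packed y∈U) wxy wy v eq′)

        together : ∀ {x y} → x ∈ U → y ∈ U → w x y ≡ true → c x ≡ c y
        together x∈U y∈U wxy = cong (indexOf codes) (tabulate-cong (coincide x∈U y∈U wxy))

        together⁻ : ∀ {x y} → x ∈ U → y ∈ U → c x ≡ c y → w x y ≡ true
        together⁻ {x} {y} x∈U y∈U eq = ∈-tabulate⁻ (subst (y ∈_)
          (indexOf-injective (code∈ y∈U) (code∈ x∈U) (sym eq)) (∈-tabulate⁺ (proj₁ (w-block y y∈U))))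

        same : ∀ W → (∀ v → W v → v ∈ U) → Packed (suc m) W → ∀ {x y} → W x → W y → c x ≡ c y
        same W W⊆U W-packed {x} {y} Wx Wy = decidable-stable (c x ≟ c y) do
          w′ , sound , complete ← comprehension W
          return (together (W⊆U x Wx) (W⊆U y Wy)
            (proj₂ (proj₂ (proj₂ (w-block x (W⊆U x Wx)))) w′ (λ v → W⊆U v ∘ sound v)
              (packed-resp complete sound W-packed) (proj₁ (w-block x (W⊆U x Wx))) (complete x Wx) y (complete y Wy)))

        class-trees : ∀ i → i < k → TreeConnected G (suc m) (class G U c i)
        class-trees i i<k with onto i i<k
        ... | x , x∈U , refl = tree-resp
          (λ v wv → let v∈U = proj₁ (proj₂ (w-block x x∈U)) v wv in v∈U , sym (together x∈U v∈U wv))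
          (λ v (v∈U , cv) → together⁻ x∈U v∈U (sym cv))
          (proj₁ (proj₂ (proj₂ (w-block x x∈U))))

        result : ∃₂ λ k c → IsComponentPartition G (suc m) U k c ×
          (∀ W → (∀ v → W v → v ∈ U) → Packed (suc m) W → ∀ {x y} → W x → W y → c x ≡ c y)
        result = k , c ,
          ( (λ v v∈U → indexOf-< (code∈ v∈U))
          , onto
          , class-trees
          , (λ i i<k W W⊆U i⊆W W-trees v Wv → let x , x∈U , cx = onto i i<k in
               W⊆U v Wv , trans (sym (same W W⊆U (tree⇒packed zero W-trees) (i⊆W x (x∈U , cx)) Wv)) cx)
          , λ W W⊆U W-trees W-max →
              let x , Wx = proj₁ (tree⇒packed zero W-trees)
                  W⊆class = λ v Wv → W⊆U v Wv , same W W⊆U (tree⇒packed zero W-trees) Wv Wx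
                  x<k = indexOf-< (code∈ (W⊆U x Wx))
              in c x , x<k , W⊆class , W-max (class G U c (c x)) (λ v → proj₁) W⊆class (class-trees (c x) x<k))
          , same

-- Parity, joins and closed trails.

parity : ℕ → Bool
parity zero    = false
parity (suc k) = not (parity k)

not-xor : ∀ a b → not a xor b ≡ not (a xor b)
not-xor false b = refl
not-xor true  false = refl
not-xor true  true  = refl

parity-+ : ∀ j k → parity (j + k) ≡ parity j xor parity k
parity-+ zero    k = refl
parity-+ (suc j) k = trans (cong not (parity-+ j k)) (sym (not-xor (parity j) (parity k)))

parity-2* : ∀ k → parity (2 * k) ≡ false
parity-2* k = trans (parity-+ k (k + 0)) (trans (cong (λ j → parity k xor parity j) (+-identityʳ k)) (xor-same (parity k)))

parity-𝟙 : ∀ b → parity (𝟙 b) ≡ b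
parity-𝟙 false = refl
parity-𝟙 true  = refl

xor-cancelʳ : ∀ a b {c} → a xor b ≡ c → a ≡ c xor b
xor-cancelʳ a b refl = sym (trans (xor-assoc a b b) (trans (cong (a xor_) (xor-same b)) (xor-identityʳ a)))

xor-telescope : ∀ a b c → (a xor b) xor (b xor c) ≡ a xor c
xor-telescope a b c = trans (xor-assoc a b _) (cong (a xor_)
  (trans (sym (xor-assoc b b c)) (trans (cong (_xor c) (xor-same b)) refl)))

-- Elements common to `p` and `q` are counted twice on the right and vanish modulo 2.
parity-∑-xor : ∀ {m} (p q : Fin m → Bool) (w : Fin m → ℕ) →
  parity (∑ (λ i → 𝟙 (p i xor q i) * w i)) ≡ parity (∑ (λ i → 𝟙 (p i) * w i)) xor parity (∑ (λ i → 𝟙 (q i) * w i))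
parity-∑-xor {m} p q w = sym (begin
  parity P xor parity Q                            ≡⟨ parity-+ P Q ⟨
  parity (P + Q)                                   ≡⟨ cong parity (∑-+ {m} _ _) ⟨
  parity (∑ (λ i → 𝟙 (p i) * w i + 𝟙 (q i) * w i)) ≡⟨ cong parity (∑-cong {m} pointwise) ⟩
  parity (∑ (λ i → 𝟙 (p i xor q i) * w i + 2 * (𝟙 (p i ∧ q i) * w i))) ≡⟨ cong parity (∑-+ {m} _ _) ⟩
  parity (R + ∑ (λ i → 2 * (𝟙 (p i ∧ q i) * w i)))   ≡⟨ cong (λ k → parity (R + k)) (∑-*ˡ 2 (λ i → 𝟙 (p i ∧ q i) * w i)) ⟩
  parity (R + 2 * K)                               ≡⟨ parity-+ R (2 * K) ⟩
  parity R xor parity (2 * K)                      ≡⟨ cong (parity R xor_) (parity-2* K) ⟩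
  parity R xor false                               ≡⟨ xor-identityʳ _ ⟩
  parity R                                         ∎)
  where
  open ≡-Reasoning
  P = ∑ (λ i → 𝟙 (p i) * w i)
  Q = ∑ (λ i → 𝟙 (q i) * w i)
  R = ∑ (λ i → 𝟙 (p i xor q i) * w i)
  K = ∑ (λ i → 𝟙 (p i ∧ q i) * w i)
  pointwise : ∀ i → 𝟙 (p i) * w i + 𝟙 (q i) * w i ≡ 𝟙 (p i xor q i) * w i + 2 * (𝟙 (p i ∧ q i) * w i)
  pointwise i with p i | q i
  ... | false | false = refl
  ... | false | true  = sym (+-identityʳ _)
  ... | true  | false = refl
  ... | true  | true  = cong ((w i + 0) +_) (sym (+-identityʳ _))

-- The repairing edge `r` lies in `b`, which excludes `j` and `a`; so a repair never removes an edge
-- that is needed for connectivity.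
xor-covers : ∀ j a r b → (r ≡ true → b ≡ true) → 𝟙 j + 𝟙 a + 𝟙 b ≤ 1 → j ≡ true ⊎ a ≡ true → (j xor a) xor r ≡ true
xor-covers true  false false _     h d        t = refl
xor-covers false true  false _     h d        t = refl
xor-covers true  false true  true  h (s≤s ()) t
xor-covers true  false true  false h d        t = contradiction (h refl) λ ()
xor-covers false true  true  true  h (s≤s ()) t
xor-covers false true  true  false h d        t = contradiction (h refl) λ ()
xor-covers true  true  _     _     h (s≤s ()) t
xor-covers false false _     _     h d        t = contradiction t λ { (inj₁ ()) ; (inj₂ ()) }

xor-weight : ∀ j a r b → (r ≡ true → b ≡ true) → 𝟙 ((j xor a) xor r) ≤ 𝟙 j + 𝟙 a + 𝟙 b
xor-weight true  a     r     b     h = ≤-trans (𝟙≤1 _) (s≤s z≤n)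
xor-weight false true  r     b     h = ≤-trans (𝟙≤1 _) (s≤s z≤n)
xor-weight false false false b     h = z≤n
xor-weight false false true  true  h = ≤-refl
xor-weight false false true  false h = contradiction (h refl) λ ()

module Trails (G : Graph) where
  open Connectivity G
  open Packing G

  δ : Vtx G → Vtx G → Bool
  δ u v = does (u ≟ᶠ v)

  δ-refl : ∀ u → δ u u ≡ true
  δ-refl u = dec-true (u ≟ᶠ u) refl

  inc : Vtx G → Edge G → ℕ
  inc v e = 𝟙 (δ (src e) v) + 𝟙 (δ (tgt e) v)

  deg : (Edge G → Bool) → Vtx G → ℕ
  deg p v = ∑ (λ e → 𝟙 (p e) * inc v e)

  inc-joins : ∀ {e u v} w → Joins G e u v → inc w e ≡ 𝟙 (δ u w) + 𝟙 (δ v w)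
  inc-joins w (inj₁ refl) = refl
  inc-joins {e} w (inj₂ refl) = +-comm (𝟙 (δ (src e) w)) _

  inc-positive : ∀ {e v} → 0 < inc v e → ∃ λ u → Joins G e v u
  inc-positive {e} {v} pos with src e ≟ᶠ v | tgt e ≟ᶠ v
  ... | yes refl | _        = tgt e , inj₁ refl
  ... | no _     | yes refl = src e , inj₂ refl

  parity-inc : ∀ {e u v} w → Joins G e u v → parity (inc w e) ≡ δ u w xor δ v w
  parity-inc {e} {u} {v} w j = trans (cong parity (inc-joins w j))
    (trans (parity-+ (𝟙 (δ u w)) _) (cong₂ _xor_ (parity-𝟙 (δ u w)) (parity-𝟙 (δ v w))))

  deg-singleton : ∀ e w → deg (insert (λ _ → false) e) w ≡ inc w e
  deg-singleton e w = begin
    deg (insert none e) w                     ≡⟨ +-identityʳ _ ⟨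
    deg (insert none e) w + 𝟙 (none e) * inc w e ≡⟨ ∑-differ e (λ f f≢e → cong (λ b → 𝟙 b * inc w f) (insert-there none e f≢e)) ⟩
    deg none w + 𝟙 (insert none e e) * inc w e ≡⟨ cong₂ _+_ (∑-zero {E G} (λ _ → refl)) (cong (λ b → 𝟙 b * inc w e) (insert-here none e)) ⟩
    inc w e + 0                               ≡⟨ +-identityʳ _ ⟩
    inc w e                                   ∎
    where
    open ≡-Reasoning
    none : Edge G → Bool
    none _ = false

  parity-deg-xor : ∀ p q v → parity (deg (λ e → p e xor q e) v) ≡ parity (deg p v) xor parity (deg q v)
  parity-deg-xor p q v = parity-∑-xor p q (inc v)

  private
    xor-⊆ : {p q A : Edge G → Bool} → (∀ e → p e ≡ true → A e ≡ true) → (∀ e → q e ≡ true → A e ≡ true) →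
      ∀ e → p e xor q e ≡ true → A e ≡ true
    xor-⊆ {p} {q} p⊆A q⊆A e t with p e in pe
    ... | true  = p⊆A e pe
    ... | false = q⊆A e t

  -- Adding the edges of a walk modulo 2 makes repeated edges cancel, and the contributions of the
  -- inner vertices telescope.
  path-set : ∀ {A u v} → Conn ⟪ A ⟫ u v →
    ∃ λ R → (∀ e → R e ≡ true → A e ≡ true) × (∀ w → parity (deg R w) ≡ δ u w xor δ v w)
  path-set {u = u} done = (λ _ → false) , (λ _ ()) , λ w →
    trans (cong parity (∑-zero {E G} (λ _ → refl))) (sym (xor-same (δ u w)))
  path-set {A} {u} {x} (step {e} {v = v} j ae c) =
    let R , R⊆A , R-odd = path-set c in
    (λ f → insert (λ _ → false) e f xor R f)
    , xor-⊆ {insert (λ _ → false) e} {R} {A} (λ f t → [ (λ { refl → ae }) , (λ ()) ]′ (insert-inv (λ _ → false) e f t)) R⊆A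
    , λ w → trans (parity-deg-xor (insert (λ _ → false) e) R w)
        (trans (cong₂ _xor_ (trans (cong parity (deg-singleton e w)) (parity-inc w j)) (R-odd w))
               (xor-telescope (δ u w) (δ v w) (δ x w)))

  -- A T-join inside `A`, where T is the set of odd vertices of `I`: the sum modulo 2 of one path in
  -- `A` for each edge of `I`.
  join : ∀ {A} (I : Edge G → Bool) → (∀ {e} → I e ≡ true → Conn ⟪ A ⟫ (src e) (tgt e)) →
    ∃ λ R → (∀ e → R e ≡ true → A e ≡ true) × (∀ w → parity (deg R w) ≡ parity (deg I w))
  join {A} I I-conn =
    let R , R⊆A , R-odd = go (filter I? (allFin _)) (λ {e} e∈ → I-conn (proj₂ (∈-filter⁻ I? {xs = allFin _} e∈)))
    in R , R⊆A , λ w → trans (R-odd w) (cong parity (trans (sum-filter (inc w) I (allFin _)) (∑-list {E G} _)))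
    where
    I? = λ e → I e Data.Bool.≟ true
    go : ∀ es → (∀ {e} → e ∈ˡ es → Conn ⟪ A ⟫ (src e) (tgt e)) →
      ∃ λ R → (∀ e → R e ≡ true → A e ≡ true) × (∀ w → parity (deg R w) ≡ parity (sum (map (inc w) es)))
    go [] conn = (λ _ → false) , (λ _ ()) , λ w → cong parity (∑-zero {E G} (λ _ → refl))
    go (e ∷ es) conn =
      let R , R⊆A , R-odd = path-set (conn (here refl))
          R′ , R′⊆A , R′-odd = go es (conn ∘ there)
      in (λ f → R f xor R′ f) , xor-⊆ {R} {R′} {A} R⊆A R′⊆A , λ w →
        trans (parity-deg-xor R R′ w) (trans (cong₂ _xor_ (trans (R-odd w) (sym (parity-inc w (inj₁ refl)))) (R′-odd w))
          (sym (parity-+ (inc w e) _)))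

  edges : Steps G → List (Edge G)
  edges = map proj₁

  Within : (Edge G → Bool) → Steps G → Set
  Within p s = ∀ e → e ∈ˡ edges s → p e ≡ true

  parity-delete : ∀ p e w → p e ≡ true → parity (deg (delete p e) w) ≡ parity (deg p w) xor parity (inc w e)
  parity-delete p e w pe = xor-cancelʳ _ (parity (inc w e))
    (trans (sym (parity-+ (deg (delete p e) w) (inc w e))) (cong parity (∑-delete p e (inc w) pe)))

  -- An odd degree at `x` supplies an edge to leave by. Once it is deleted, oddness has moved to the
  -- new vertex, so the trail cannot get stuck before `y`. The recursion is on the number `k` of
  -- edges left.
  trail : ∀ k (p : Edge G → Bool) → card p ≡ k → ∀ x y → (∀ w → parity (deg p w) ≡ δ x w xor δ y w) →
    ∃ λ s → IsTrail G x s × Within p s × walkEnd G x s ≡ y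
  trail k p eq x y odd with x ≟ᶠ y
  ... | yes refl = [] , (tt , []) , (λ _ ()) , refl
  ... | no x≢y with ∑-positive {E G} (λ e → 𝟙 (p e) * inc x e) (odd-positive (deg p x) odd-x)
    where
    odd-x : parity (deg p x) ≡ true
    odd-x = trans (odd x) (cong₂ _xor_ (δ-refl x) (dec-false (y ≟ᶠ x) (x≢y ∘ sym)))
    odd-positive : ∀ k → parity k ≡ true → 0 < k
    odd-positive (suc k) _ = s≤s z≤n
  ... | e , pos with p e in pe
  trail zero p eq x y odd | no x≢y | e , pos | true = contradiction (trans (card-delete p e pe) eq) λ ()
  trail (suc k) p eq x y odd | no x≢y | e , pos | true
    with inc-positive (subst (0 <_) (+-identityʳ (inc x e)) pos)
  ... | x′ , j with trail k (delete p e) (suc-injective (trans (card-delete p e pe) eq)) x′ y odd′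
    where
    odd′ : ∀ w → parity (deg (delete p e) w) ≡ δ x′ w xor δ y w
    odd′ w = begin
      parity (deg (delete p e) w)                    ≡⟨ parity-delete p e w pe ⟩
      parity (deg p w) xor parity (inc w e)          ≡⟨ cong₂ _xor_ (odd w) (parity-inc w (Joins-sym j)) ⟩
      (δ x w xor δ y w) xor (δ x′ w xor δ x w)       ≡⟨ xor-comm (δ x w xor δ y w) _ ⟩
      (δ x′ w xor δ x w) xor (δ x w xor δ y w)       ≡⟨ xor-telescope (δ x′ w) (δ x w) (δ y w) ⟩
      δ x′ w xor δ y w                               ∎
      where open ≡-Reasoning
  ... | s , (js , u) , s⊆ , end =
      (e , x′) ∷ s
    , ((j , js) , All.tabulate (λ {f} f∈ e≡f → proj₁ (delete-inv p e f (s⊆ f f∈)) (sym e≡f)) ∷ u)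
    , (λ { _ (here refl) → pe ; f (there f∈) → proj₂ (delete-inv p e f (s⊆ f f∈)) })
    , end

  walk-++ : ∀ {u} s t → ValidWalk G u s → ValidWalk G (walkEnd G u s) t → ValidWalk G u (s ++ t)
  walk-++ []      t _        v  = v
  walk-++ (_ ∷ s) t (j , js) v  = j , walk-++ s t js v

  end-++ : ∀ {u} s t → walkEnd G u (s ++ t) ≡ walkEnd G (walkEnd G u s) t
  end-++ []      t = refl
  end-++ (_ ∷ s) t = end-++ s t

  ends-visited : ∀ {u} s → ValidWalk G u s → ∀ {e x y} → e ∈ˡ edges s → Joins G e x y → y ∈ˡ u ∷ map proj₂ s
  ends-visited ((_ , _) ∷ s) (inj₁ refl , js) (here refl) (inj₁ refl) = there (here refl)
  ends-visited ((_ , _) ∷ s) (inj₁ refl , js) (here refl) (inj₂ refl) = here refl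
  ends-visited ((_ , _) ∷ s) (inj₂ refl , js) (here refl) (inj₁ refl) = here refl
  ends-visited ((_ , _) ∷ s) (inj₂ refl , js) (here refl) (inj₂ refl) = there (here refl)
  ends-visited (_ ∷ s)       (_ , js)         (there e∈) j           = there (ends-visited s js e∈ j)

  splice : ∀ {x} c → IsClosedTrail G x c → ∀ u s → IsTrail G u s → x ∈ˡ u ∷ map proj₂ s →
    (∀ {e} → e ∈ˡ edges c → ¬ e ∈ˡ edges s) →
    ∃ λ s′ → IsTrail G u s′ × walkEnd G u s′ ≡ walkEnd G u s × length s′ ≡ length c + length s
      × (∀ {e} → e ∈ˡ edges s′ → e ∈ˡ edges c ⊎ e ∈ˡ edges s)
  splice c ((cv , cu) , closed) u s (sv , su) (here refl) disjoint =
      c ++ s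
    , (walk-++ c s cv (subst (λ x → ValidWalk G x s) (sym closed) sv)
      , subst Unique (sym (map-++ proj₁ c s)) (Unique.++⁺ cu su (λ (a , b) → disjoint a b)))
    , trans (end-++ c s) (cong (λ x → walkEnd G x s) closed)
    , length-++ c
    , (λ {e} e∈ → ∈-++⁻ (edges c) (subst (e ∈ˡ_) (map-++ proj₁ c s) e∈))
  splice c cc u ((e , v) ∷ s) ((j , sv) , e∉ ∷ su) (there x∈) disjoint =
    let s′ , (v′ , u′) , end , len , inv = splice c cc v s (sv , su) x∈ (λ a b → disjoint a (there b)) in
      (e , v) ∷ s′
    , ((j , v′) , All.tabulate (λ f∈ e≡f → [ (λ a → disjoint a (here (sym e≡f))) , (λ b → All.lookup e∉ b e≡f) ]′ (inv f∈)) ∷ u′)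
    , end
    , trans (cong suc len) (sym (+-suc (length c) (length s)))
    , λ { (here refl) → inj₂ (here refl)
        ; (there f∈)  → [ inj₁ , inj₂ ∘ there ]′ (inv f∈) }

  -- `timesThrough` counts arrivals only. The two boundary terms account for the unmatched departure
  -- and arrival, which makes the induction work for open walks.
  walk-degree : ∀ {u} s → ValidWalk G u s → ∀ w →
    sum (map (inc w) (edges s)) + 𝟙 (δ (walkEnd G u s) w) ≡ 2 * timesThrough G s w + 𝟙 (δ u w)
  walk-degree {u} [] _ w = refl
  walk-degree {u} ((e , v) ∷ s) (j , js) w = begin
    inc w e + S + d                       ≡⟨ cong (λ i → i + S + d) (inc-joins w j) ⟩
    (a + b) + S + d                       ≡⟨ +-assoc (a + b) S d ⟩
    (a + b) + (S + d)                     ≡⟨ cong ((a + b) +_) (walk-degree s js w) ⟩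
    (a + b) + (2 * t + b)                 ≡⟨ solve 3 (λ a b t → (a :+ b) :+ (con 2 :* t :+ b) := con 2 :* (b :+ t) :+ a) refl a b t ⟩
    2 * (b + t) + a                       ≡⟨ cong (λ k → 2 * k + a) (times v) ⟩
    2 * timesThrough G ((e , v) ∷ s) w + a ∎
    where
    open ≡-Reasoning
    open +-*-Solver
    S = sum (map (inc w) (edges s))
    d = 𝟙 (δ (walkEnd G v s) w)
    a = 𝟙 (δ u w)
    b = 𝟙 (δ v w)
    t = timesThrough G s w
    times : ∀ v → 𝟙 (δ v w) + t ≡ timesThrough G ((e , v) ∷ s) w
    times v with v ≟ᶠ w
    ... | yes _ = refl
    ... | no _  = refl

  closed-degree : ∀ {u} s → IsClosedTrail G u s → ∀ w → deg (member (edges s)) w ≡ 2 * timesThrough G s w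
  closed-degree {u} s ((v , unique) , closed) w = trans (sum-unique (inc w) unique)
    (+-cancelʳ-≡ (𝟙 (δ u w)) _ _ (subst (λ x → sum (map (inc w) (edges s)) + 𝟙 (δ x w) ≡ 2 * timesThrough G s w + 𝟙 (δ u w)) closed (walk-degree s v w)))

  closed-even : ∀ {u} s → IsClosedTrail G u s → ∀ w → parity (deg (member (edges s)) w) ≡ false
  closed-even s closed w = trans (cong parity (closed-degree s closed w)) (parity-2* (timesThrough G s w))

  closed-times : ∀ {u} s → IsClosedTrail G u s → ∀ J → Within J s → ∀ w → 2 * timesThrough G s w ≤ deg J w
  closed-times s closed@((_ , unique) , _) J s⊆J w = subst (_≤ deg J w)
    (trans (sym (sum-unique (inc w) unique)) (closed-degree s closed w)) (sum-unique≤ (inc w) J unique (s⊆J _))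

  euler : (J : Edge G → Bool) → (∀ w → parity (deg J w) ≡ false) → Connected ⟪ J ⟫ → (u : Vtx G) →
    ¬ ¬ ∃ λ s → IsSpanningClosedTrail G u s × Within J s
  euler J even J-conn u = do
    s , (closed , s⊆J) , longest ← maximiser
      (λ s → IsClosedTrail G u s × Within J s) length (E G) short ([] , ((tt , []) , refl) , λ _ ())
    return (s , (closed , λ v → member⁻ (spanning s closed s⊆J longest v)) , s⊆J)
    where
    short : ∀ s → IsClosedTrail G u s × Within J s → length s ≤ E G
    short s (((_ , unique) , _) , s⊆J) = subst (_≤ E G) (length-map proj₁ s)
      (≤-trans (length-unique≤ J unique (s⊆J _)) (card≤ J))

    spanning : ∀ s → IsClosedTrail G u s → Within J s →
      (∀ s′ → IsClosedTrail G u s′ × Within J s′ → length s′ ≤ length s) →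
      ∀ v → member (u ∷ map proj₂ s) v ≡ true
    spanning s closed s⊆J longest v with member (u ∷ map proj₂ s) v in unvisited
    ... | true  = refl
    ... | false with conn-leaves (member (u ∷ map proj₂ s)) (J-conn u v) (member⁺ {i = u} {u ∷ map proj₂ s} (here refl)) unvisited
    ... | e , x , y , j , Je , x-visited , y-unvisited = contradiction (longest s′
            ( (trail′ , trans end (proj₂ closed))
            , (λ f f∈ → [ (λ { (here refl) → Je ; (there f∈t) → proj₁ (rest-inv f (proj₂ (delete-inv rest e f (t⊆ f f∈t)))) }) , s⊆J f ]′ (inv f∈))))
          (<⇒≱ (subst (length s <_) (sym len) (s≤s (m≤n+m (length s) (length t)))))
      where
      rest : Edge G → Bool
      rest f = J f xor member (edges s) f

      rest-inv : ∀ f → rest f ≡ true → J f ≡ true × ¬ (f ∈ˡ edges s)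
      rest-inv f r = inJ , λ f∈ → contradiction (trans (sym r) (cong₂ _xor_ inJ (member⁺ f∈))) λ ()
        where
        inJ : J f ≡ true
        inJ with J f in Jf | member (edges s) f in mf
        ... | true  | _    = refl
        ... | false | true = trans (sym Jf) (s⊆J f (member⁻ mf))

      e∉s : ¬ e ∈ˡ edges s
      e∉s e∈ = contradiction (trans (sym (member⁺ (ends-visited s (proj₁ (proj₁ closed)) e∈ j))) y-unvisited) λ ()

      rest-e : rest e ≡ true
      rest-e with member (edges s) e in me
      ... | true  = contradiction (member⁻ me) e∉s
      ... | false = trans (xor-identityʳ (J e)) Je

      odd : ∀ w → parity (deg (delete rest e) w) ≡ δ y w xor δ x w
      odd w = trans (parity-delete rest e w rest-e) (trans
        (cong (_xor parity (inc w e)) (trans (parity-deg-xor J (member (edges s)) w) (cong₂ _xor_ (even w) (closed-even s closed w))))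
        (parity-inc w (Joins-sym j)))

      return-trail = trail _ (delete rest e) refl y x odd
      t = proj₁ return-trail
      t-trail = proj₁ (proj₂ return-trail)
      t⊆ = proj₁ (proj₂ (proj₂ return-trail))
      t-end = proj₂ (proj₂ (proj₂ return-trail))

      spliced = splice ((e , y) ∷ t)
        (((j , proj₁ t-trail) , All.tabulate (λ {f} f∈ e≡f → proj₁ (delete-inv rest e f (t⊆ f f∈)) (sym e≡f)) ∷ proj₂ t-trail) , t-end)
        u s (proj₁ closed) (member⁻ x-visited)
        (λ { (here refl) → e∉s ; {f} (there f∈) → proj₂ (rest-inv f (proj₂ (delete-inv rest e f (t⊆ f f∈)))) })
      s′ = proj₁ spliced
      trail′ = proj₁ (proj₂ spliced)
      end = proj₁ (proj₂ (proj₂ spliced))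
      len = proj₁ (proj₂ (proj₂ (proj₂ spliced)))
      inv = proj₂ (proj₂ (proj₂ (proj₂ spliced)))

  -- A₁ keeps the subgraph connected while a join in A₂ repairs the parities.
  spanning-trail : (X : Subset (n G)) (f : Vtx G → ℕ) (J₀ I A₁ A₂ : Edge G → Bool) → Vtx G →
    (∀ e → 𝟙 (J₀ e) + 𝟙 (A₁ e) + 𝟙 (A₂ e) ≤ 1) →
    (∀ w → parity (deg J₀ w) ≡ parity (deg I w)) →
    (∀ {e} → I e ≡ true ⊎ A₁ e ≡ true → Conn ⟪ A₂ ⟫ (src e) (tgt e)) →
    Connected (λ e → J₀ e ≡ true ⊎ A₁ e ≡ true) →
    (∀ v → v ∈ X → deg J₀ v + deg A₁ v + deg A₂ v ≤ suc (2 * f v)) →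
    ¬ ¬ HasSCT G f X
  spanning-trail X f J₀ I A₁ A₂ u disjoint I-parity A₂-conn J-conn bound =
    -- `R₁` repairs the odd degrees of `J₀`, which are those of `I`, and `R₂` repairs those of `A₁`.
    -- Both stay inside `A₂`, so their sum does too.
    let R₁ , R₁⊆ , R₁-odd = join {A₂} I (A₂-conn ∘ inj₁)
        R₂ , R₂⊆ , R₂-odd = join {A₂} A₁ (A₂-conn ∘ inj₂)
        R = λ e → R₁ e xor R₂ e
        R⊆ = xor-⊆ {R₁} {R₂} {A₂} R₁⊆ R₂⊆
        J = λ e → (J₀ e xor A₁ e) xor R e
        even = λ w → begin
          parity (deg J w)
            ≡⟨ parity-deg-xor (λ e → J₀ e xor A₁ e) R w ⟩
          parity (deg (λ e → J₀ e xor A₁ e) w) xor parity (deg R w)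
            ≡⟨ cong₂ _xor_ (parity-deg-xor J₀ A₁ w) (parity-deg-xor R₁ R₂ w) ⟩
          (parity (deg J₀ w) xor parity (deg A₁ w)) xor (parity (deg R₁ w) xor parity (deg R₂ w))
            ≡⟨ cong₂ _xor_ (cong (_xor parity (deg A₁ w)) (I-parity w)) (cong₂ _xor_ (R₁-odd w) (R₂-odd w)) ⟩
          (parity (deg I w) xor parity (deg A₁ w)) xor (parity (deg I w) xor parity (deg A₁ w))
            ≡⟨ xor-same (parity (deg I w) xor parity (deg A₁ w)) ⟩
          false ∎
    in do
    s , sct , s⊆J ← euler J even (λ x y → conn-map (λ {e} → xor-covers _ _ _ _ (R⊆ e) (disjoint e)) (J-conn x y)) u
    return (u , s , sct , λ v v∈X → half (timesThrough G s v) (f v)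
      (≤-trans (closed-times s (proj₁ sct) J s⊆J v) (≤-trans (J-deg R R⊆ v) (bound v v∈X))))
    where
    open ≡-Reasoning
    -- Here parity absorbs the extra unit in `2 f v + 1`.
    half : ∀ a b → 2 * a ≤ suc (2 * b) → a ≤ b
    half zero    b       _ = z≤n
    half (suc a) zero    h rewrite +-suc a (a + 0) = contradiction h λ { (s≤s ()) }
    half (suc a) (suc b) h rewrite +-suc a (a + 0) | +-suc b (b + 0) with h
    ... | s≤s (s≤s h′) = s≤s (half a b h′)
    J-deg : ∀ R → (∀ e → R e ≡ true → A₂ e ≡ true) → ∀ v → deg (λ e → (J₀ e xor A₁ e) xor R e) v ≤ deg J₀ v + deg A₁ v + deg A₂ v
    J-deg R R⊆ v = ≤-trans (∑-mono {E G} pointwise)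
      (≤-reflexive (∑-+₃ {E G} _ _ _))
      where
      pointwise : ∀ e → 𝟙 ((J₀ e xor A₁ e) xor R e) * inc v e ≤ 𝟙 (J₀ e) * inc v e + 𝟙 (A₁ e) * inc v e + 𝟙 (A₂ e) * inc v e
      pointwise e = ≤-trans (*-monoˡ-≤ (inc v e) (xor-weight (J₀ e) (A₁ e) (R e) (A₂ e) (R⊆ e))) (≤-reflexive
        (trans (*-distribʳ-+ (inc v e) (𝟙 (J₀ e) + 𝟙 (A₁ e)) _) (cong (_+ 𝟙 (A₂ e) * inc v e) (*-distribʳ-+ (inc v e) (𝟙 (J₀ e)) _))))

-- Roles of edges, swaps, and the edges they free.

data Role : Set where
  tree : Fin 2 → Role
  held free : Role

isTree : Fin 2 → Role → Bool
isTree i (tree j) = does (i ≟ᶠ j)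
isTree i held     = false
isTree i free     = false

isHeld isFree : Role → Bool
isHeld held     = true
isHeld (tree _) = false
isHeld free     = false

isFree free     = true
isFree (tree _) = false
isFree held     = false

isTree⁻ : ∀ i {r} → isTree i r ≡ true → r ≡ tree i
isTree⁻ i {tree j} eq with i ≟ᶠ j
... | yes refl = refl

isTree⁺ : ∀ i {r} → r ≡ tree i → isTree i r ≡ true
isTree⁺ i refl = dec-true (i ≟ᶠ i) refl

weight-update : ∀ {m} (φ : Role → Bool) (w : Fin m → ℕ) (σ : Fin m → Role) i r →
  ∑ (λ e → 𝟙 (φ (updateAt σ i (const r) e)) * w e) + 𝟙 (φ (σ i)) * w i
  ≡ ∑ (λ e → 𝟙 (φ (σ e)) * w e) + 𝟙 (φ r) * w i
weight-update φ w σ i r = trans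
  (∑-differ i (λ j j≢i → cong (λ s → 𝟙 (φ s) * w j) (updateAt-minimal j i σ j≢i)))
  (cong (λ s → ∑ (λ e → 𝟙 (φ (σ e)) * w e) + 𝟙 (φ s) * w i) (updateAt-updates i σ))

module _ {m : ℕ} (σ : Fin m → Role) (z y : Fin m) where

  swap : Fin m → Role
  swap = updateAt (updateAt σ y (const free)) z (const (σ y))

  swap-z : swap z ≡ σ y
  swap-z = updateAt-updates z (updateAt σ y (const free))

  module _ (z-free : σ z ≡ free) (y-used : σ y ≢ free) where

    z≢y : z ≢ y
    z≢y refl = y-used z-free

    swap-y : swap y ≡ free
    swap-y = trans (updateAt-minimal y z _ (z≢y ∘ sym)) (updateAt-updates y σ)

    swap-other : ∀ {e} → e ≢ z → e ≢ y → swap e ≡ σ e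
    swap-other {e} e≢z e≢y = trans (updateAt-minimal e z _ e≢z) (updateAt-minimal e y σ e≢y)

    swap-weight : (φ : Role → Bool) → φ free ≡ false → (w : Fin m → ℕ) →
      ∑ (λ e → 𝟙 (φ (swap e)) * w e) + 𝟙 (φ (σ y)) * w y
      ≡ ∑ (λ e → 𝟙 (φ (σ e)) * w e) + 𝟙 (φ (σ y)) * w z
    swap-weight φ φfree w = begin
      ∑ new + a        ≡⟨ cong (_+ a) (+-identityʳ (∑ new)) ⟨
      ∑ new + 0 + a    ≡⟨ cong (λ b → ∑ new + 𝟙 b * w z + a) (trans (cong φ (trans (updateAt-minimal z y σ z≢y) z-free)) φfree) ⟨
      ∑ new + 𝟙 (φ (updateAt σ y (const free) z)) * w z + a ≡⟨ cong (_+ a) (weight-update φ w (updateAt σ y (const free)) z (σ y)) ⟩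
      ∑ mid + b + a    ≡⟨ +-assoc (∑ mid) b a ⟩
      ∑ mid + (b + a)  ≡⟨ cong (∑ mid +_) (+-comm b a) ⟩
      ∑ mid + (a + b)  ≡⟨ +-assoc (∑ mid) a b ⟨
      ∑ mid + a + b    ≡⟨ cong (_+ b) (weight-update φ w σ y free) ⟩
      ∑ old + 𝟙 (φ free) * w y + b ≡⟨ cong (λ f → ∑ old + 𝟙 f * w y + b) φfree ⟩
      ∑ old + 0 + b    ≡⟨ cong (_+ b) (+-identityʳ (∑ old)) ⟩
      ∑ old + b        ∎
      where
      open ≡-Reasoning
      new = λ e → 𝟙 (φ (swap e)) * w e
      mid = λ e → 𝟙 (φ (updateAt σ y (const free) e)) * w e
      old = λ e → 𝟙 (φ (σ e)) * w e
      a = 𝟙 (φ (σ y)) * w y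
      b = 𝟙 (φ (σ y)) * w z

    swap-card : (φ : Role → Bool) → φ free ≡ false → card (φ ∘ swap) ≡ card (φ ∘ σ)
    swap-card φ φfree = +-cancelʳ-≡ (𝟙 (φ (σ y)) * 1) _ _
      (subst₂ (λ a b → a + 𝟙 (φ (σ y)) * 1 ≡ b + 𝟙 (φ (σ y)) * 1)
        (∑-cong {m} (λ e → *-identityʳ _)) (∑-cong {m} (λ e → *-identityʳ _)) (swap-weight φ φfree (λ _ → 1)))

-- Every edge lies in one of two spanning trees, is held (reserved for deletion, at most g v edges
-- at each v ∈ X), or is free.
module Exchanges (G : Graph) (X : Subset (n G)) (independent : Independent G X) (g : Vtx G → ℕ) where
  open Connectivity G
  open Packing G
  open Trails G

  -- By independence and looplessness, an edge at `x` has just one end in `X`. Holding an edge at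
  -- `x`, or swapping two edges there, therefore leaves the held degrees elsewhere in `X` alone.
  inc-X : ∀ {e x} → x ∈ X → 0 < inc x e → inc x e ≡ 1 × (∀ {v} → v ∈ X → v ≢ x → inc v e ≡ 0)
  inc-X {e} {x} x∈X pos with src e ≟ᶠ x | tgt e ≟ᶠ x
  ... | yes s≡x  | yes t≡x = contradiction (trans s≡x (sym t≡x)) (loopless G e)
  ... | yes refl | no _    = refl , λ {v} v∈X v≢x → cong₂ (λ a b → 𝟙 a + 𝟙 b)
    (dec-false (src e ≟ᶠ v) (v≢x ∘ sym)) (dec-false (tgt e ≟ᶠ v) (λ { refl → independent e (x∈X , v∈X) }))
  ... | no _     | yes refl = refl , λ {v} v∈X v≢x → cong₂ (λ a b → 𝟙 a + 𝟙 b)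
    (dec-false (src e ≟ᶠ v) (λ { refl → independent e (v∈X , x∈X) })) (dec-false (tgt e ≟ᶠ v) (v≢x ∘ sym))

  State : Set
  State = Edge G → Role

  trees : Fin 2 → State → Edge G → Bool
  trees i σ e = isTree i (σ e)

  holds : State → Edge G → Bool
  holds σ e = isHeld (σ e)

  record Valid (σ : State) : Set where
    field
      connected : ∀ i → Connected ⟪ trees i σ ⟫
      thin      : ∀ i → card (trees i σ) < n G
      capacity  : ∀ {x} → x ∈ X → deg (holds σ) x ≤ g x
      held-at   : ∀ {e} → σ e ≡ held → ∃ λ x → x ∈ X × 0 < inc x e
  open Valid

  data Swappable (σ : State) (z y : Edge G) : Set where
    in-tree  : ∀ i → σ y ≡ tree i → Connected (Exchange (trees i σ) y z) → Swappable σ z y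
    at-vertex : ∀ {x} → σ y ≡ held → x ∈ X → 0 < inc x z → 0 < inc x y → Swappable σ z y

  swappable-used : ∀ {σ z y} → Swappable σ z y → σ y ≢ free
  swappable-used (in-tree i eq _)         eq′ = contradiction (trans (sym eq) eq′) λ ()
  swappable-used (at-vertex eq _ _ _) eq′ = contradiction (trans (sym eq) eq′) λ ()

  module _ {σ z y} (z-free : σ z ≡ free) (sw : Swappable σ z y) where
    private
      used = swappable-used sw

    swap-⊇ : ∀ {r e} → r ≢ free → e ≢ y → σ e ≡ r → swap σ z y e ≡ r
    swap-⊇ {e = e} r≢free e≢y σe with e ≟ᶠ z
    ... | yes refl = contradiction (trans (sym σe) z-free) r≢free
    ... | no e≢z   = trans (swap-other σ z y z-free used e≢z e≢y) σe

    swap-⊆ : ∀ {r e} → r ≢ free → e ≢ z → swap σ z y e ≡ r → σ e ≡ r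
    swap-⊆ {e = e} r≢free e≢z eq with e ≟ᶠ y
    ... | yes refl = contradiction (trans (sym eq) (swap-y σ z y z-free used)) r≢free
    ... | no e≢y   = trans (sym (swap-other σ z y z-free used e≢z e≢y)) eq

    swap-conn : ∀ i → Connected ⟪ trees i σ ⟫ → Connected ⟪ trees i (swap σ z y) ⟫
    swap-conn i conn u v = go sw
      where
      kept : ∀ {e} → e ≢ y → trees i σ e ≡ true → trees i (swap σ z y) e ≡ true
      kept {e} e≢y t = isTree⁺ i {swap σ z y e} (swap-⊇ (λ ()) e≢y (isTree⁻ i {σ e} t))
      other : σ y ≢ tree i → Conn ⟪ trees i (swap σ z y) ⟫ u v
      other σy≢ = conn-map (λ {e} t → kept {e} (λ { refl → σy≢ (isTree⁻ i {σ y} t) }) t) (conn u v)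
      go : Swappable σ z y → Conn ⟪ trees i (swap σ z y) ⟫ u v
      go (at-vertex eq _ _ _) = other (λ eq′ → contradiction (trans (sym eq) eq′) λ ())
      go (in-tree j eq exch) with i ≟ᶠ j
      ... | no i≢j   = other (λ eq′ → i≢j (tree-injective (trans (sym eq′) eq)))
        where
        tree-injective : ∀ {i j} → tree i ≡ tree j → i ≡ j
        tree-injective refl = refl
      ... | yes refl = conn-map
        (λ { (inj₁ refl) → isTree⁺ i (trans (swap-z σ z y) eq) ; {e} (inj₂ (e≢y , t)) → kept {e} e≢y t }) (exch u v)

    swap-deg : ∀ {x} → x ∈ X → deg (holds (swap σ z y)) x ≡ deg (holds σ) x
    swap-deg {x} x∈X = +-cancelʳ-≡ (𝟙 (isHeld (σ y)) * inc x y) _ _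
      (trans (swap-weight σ z y z-free used isHeld refl (inc x)) (cong (deg (holds σ) x +_) (sym (go sw))))
      where
      go : Swappable σ z y → 𝟙 (isHeld (σ y)) * inc x y ≡ 𝟙 (isHeld (σ y)) * inc x z
      go (in-tree j eq _) rewrite eq = refl
      go (at-vertex {x′} eq x′∈X x′z x′y) with x ≟ᶠ x′
      ... | yes refl = cong (𝟙 (isHeld (σ y)) *_) (trans (proj₁ (inc-X x∈X x′y)) (sym (proj₁ (inc-X x∈X x′z))))
      ... | no x≢x′  = cong (𝟙 (isHeld (σ y)) *_) (trans (proj₂ (inc-X x′∈X x′y) x∈X x≢x′) (sym (proj₂ (inc-X x′∈X x′z) x∈X x≢x′)))

    swap-valid : Valid σ → Valid (swap σ z y)
    swap-valid V .connected i = swap-conn i (V .connected i)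
    swap-valid V .thin i = subst (_< n G) (sym (swap-card σ z y z-free used (isTree i) refl)) (V .thin i)
    swap-valid V .capacity x∈X = subst (_≤ g _) (sym (swap-deg x∈X)) (V .capacity x∈X)
    swap-valid V .held-at {e} eq with e ≟ᶠ z
    ... | no e≢z   = V .held-at (swap-⊆ (λ ()) e≢z eq)
    ... | yes refl = go sw
      where
      go : Swappable σ z y → ∃ λ x → x ∈ X × 0 < inc x z
      go (at-vertex _ x∈X xz _) = _ , x∈X , xz
      go (in-tree i σy _) = contradiction (trans (sym eq) (trans (swap-z σ z y) σy)) λ ()

  hold-valid : ∀ {σ z x} → Valid σ → σ z ≡ free → x ∈ X → 0 < inc x z → deg (holds σ) x < g x →
    Valid (updateAt σ z (const held))
  hold-valid {σ} {z} {x} V z-free x∈X xz room = record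
    { connected = λ i u v → conn-map (λ {e} t → subst (λ r → isTree i r ≡ true) (sym (same {e} (λ { refl → contradiction (trans (sym (cong (isTree i) z-free)) t) λ () }))) t) (V .connected i u v)
    ; thin      = λ i → ≤-<-trans (∑-mono {E G} (λ e → 𝟙-mono {isTree i (σ′ e)} (old-tree i e))) (V .thin i)
    ; capacity  = cap
    ; held-at   = λ {e} eq → at e eq
    }
    where
    σ′ = updateAt σ z (const held)
    same : ∀ {e} → e ≢ z → σ′ e ≡ σ e
    same {e} e≢z = updateAt-minimal e z σ e≢z
    old-tree : ∀ i e → isTree i (σ′ e) ≡ true → isTree i (σ e) ≡ true
    old-tree i e t with e ≟ᶠ z
    ... | yes refl = contradiction (trans (sym (cong (isTree i) (updateAt-updates z σ))) t) λ ()
    ... | no e≢z   = subst (λ r → isTree i r ≡ true) (same e≢z) t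
    deg-hold : ∀ v → deg (holds σ′) v ≡ deg (holds σ) v + inc v z
    deg-hold v = trans (sym (+-identityʳ _)) (trans
      (subst (λ r → deg (holds σ′) v + 𝟙 (isHeld r) * inc v z ≡ deg (holds σ) v + 1 * inc v z) z-free (weight-update isHeld (inc v) σ z held))
      (cong (deg (holds σ) v +_) (*-identityˡ (inc v z))))
    cap : ∀ {v} → v ∈ X → deg (holds σ′) v ≤ g v
    cap {v} v∈X with v ≟ᶠ x
    ... | yes refl = ≤-trans (≤-reflexive (trans (deg-hold v) (trans (cong (deg (holds σ) v +_) (proj₁ (inc-X x∈X xz))) (+-comm _ 1)))) room
    ... | no v≢x   = ≤-trans (≤-reflexive (trans (deg-hold v) (trans (cong (deg (holds σ) v +_) (proj₂ (inc-X x∈X xz) v∈X v≢x)) (+-identityʳ _)))) (V .capacity v∈X)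
    at : ∀ e → σ′ e ≡ held → ∃ λ x → x ∈ X × 0 < inc x e
    at e eq with e ≟ᶠ z
    ... | yes refl = x , x∈X , xz
    ... | no e≢z   = V .held-at (trans (sym (same e≢z)) eq)

  hold-card : ∀ {σ z} → σ z ≡ free → card (holds (updateAt σ z (const held))) ≡ suc (card (holds σ))
  hold-card {σ} {z} z-free = trans (sym (+-identityʳ _)) (trans
    (subst (λ r → card (holds σ′) + 𝟙 (isHeld r) ≡ card (holds σ) + 𝟙 (isHeld (σ′ z))) z-free
      (∑-differ z (λ e e≢z → cong (𝟙 ∘ isHeld) (updateAt-minimal e z σ e≢z))))
    (trans (cong (λ r → card (holds σ) + 𝟙 (isHeld r)) (updateAt-updates z σ)) (+-comm _ 1)))
    where σ′ = updateAt σ z (const held)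

  initial : TreeConnected G 2 (AllVertices G) → ¬ ¬ ∃ Valid
  initial tc = let (root , _) , B , _ , B-conn , disjoint = tree⇒packed 0F tc in do
    thinned ← all-¬¬ λ i → thin-spanning (B i) (λ u v → B-conn i u v tt tt) root
    let q = proj₁ ∘ thinned
        q⊆B = proj₁ ∘ proj₂ ∘ thinned
        σ = λ e → if q 0F e then tree 0F else if q 1F e then tree 1F else free
        agree = roles q (λ e t t′ → disjoint 0F 1F e (λ ()) (q⊆B 0F e t) (q⊆B 1F e t′))
    return (σ , record
      { connected = λ i u v → conn-map (λ {e} t → trans (agree i e) t) (proj₁ (proj₂ (proj₂ (thinned i))) u v)
      ; thin      = λ i → subst (_< n G) (∑-cong {E G} (λ e → cong 𝟙 (sym (agree i e)))) (proj₂ (proj₂ (proj₂ (thinned i))))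
      ; capacity  = λ {x} _ → subst (_≤ g x) (sym (∑-zero {E G} (λ e → cong (λ b → 𝟙 b * inc x e) (none-held (q 0F e) (q 1F e))))) z≤n
      ; held-at   = λ {e} σe → contradiction (trans (sym (none-held (q 0F e) (q 1F e))) (cong isHeld σe)) λ ()
      })
    where
    none-held : ∀ a b → isHeld (if a then tree 0F else if b then tree 1F else free) ≡ false
    none-held true  _     = refl
    none-held false true  = refl
    none-held false false = refl
    roles : (q : Fin 2 → Edge G → Bool) → (∀ e → q 0F e ≡ true → q 1F e ≢ true) → ∀ i e →
      isTree i (if q 0F e then tree 0F else if q 1F e then tree 1F else free) ≡ q i e
    roles q disj 0F e with q 0F e | q 1F e
    ... | true  | _     = refl
    ... | false | true  = refl
    ... | false | false = refl
    roles q disj 1F e with q 0F e | q 1F e | disj e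
    ... | true  | true  | d = contradiction refl (d refl)
    ... | true  | false | _ = refl
    ... | false | true  | _ = refl
    ... | false | false | _ = refl

  module Reachability (σ₀ : State) (σ₀-valid : Valid σ₀)
    (σ₀-max : ∀ σ → Valid σ → card (holds σ) ≤ card (holds σ₀)) where

    data Reach : State → Set where
      origin : Reach σ₀
      move   : ∀ {σ z y} → Reach σ → σ z ≡ free → Swappable σ z y → Reach (swap σ z y)

    Freed : Edge G → Set
    Freed e = ∃ λ σ → Reach σ × σ e ≡ free

    freed : ∀ {σ z y} → Reach σ → σ z ≡ free → Swappable σ z y → Freed y
    freed {σ} {z} {y} ρ z-free sw = _ , move ρ z-free sw , swap-y σ z y z-free (swappable-used sw)

    reach-valid : ∀ {σ} → Reach σ → Valid σ × card (holds σ) ≡ card (holds σ₀)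
    reach-valid origin = σ₀-valid , refl
    reach-valid (move {σ} {z} {y} ρ z-free sw) = let V , eq = reach-valid ρ in
      swap-valid z-free sw V , trans (swap-card σ z y z-free (swappable-used sw) isHeld refl) eq

    -- With room left at `x`, the edge `z` could be held as well. Swaps preserve the number of held
    -- edges, so this would exceed the maximum attained at `σ₀`.
    saturated : ∀ {σ z x} → Reach σ → σ z ≡ free → x ∈ X → 0 < inc x z → deg (holds σ) x ≡ g x
    saturated {σ} {z} {x} ρ z-free x∈X xz = ≤-antisym (V .capacity x∈X) (≮⇒≥ λ room →
      <⇒≱ (≤-reflexive (sym (trans (hold-card {σ} z-free) (cong suc eq)))) (σ₀-max _ (hold-valid V z-free x∈X xz room)))
      where
      V = proj₁ (reach-valid ρ)
      eq = proj₂ (reach-valid ρ)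

    -- Each edge of a minimal join of the ends of `z` in a tree can itself be swapped for `z`, and
    -- so is freed.
    freed-join : ∀ {σ z} → Reach σ → σ z ≡ free → ¬ ¬ (∀ i → Conn (λ e → σ e ≡ tree i × Freed e) (src z) (tgt z))
    freed-join {σ} {z} ρ z-free = all-¬¬ λ i → do
      c ← exchangeable-join (trees i σ) (proj₁ (reach-valid ρ) .connected i) z
      return (conn-map (λ {y} (t , conn) → let σy = isTree⁻ i {σ y} t in
        σy , freed ρ z-free (in-tree i σy conn)) c)

    -- A swapped-in edge z is already spanned by the freed edges of its new tree, so no swap enlarges
    -- the components of the freed part of either tree.
    freed-span : ∀ {σ} → Reach σ →
      ¬ ¬ (∀ i e → σ e ≡ tree i → Freed e → Conn (λ e → σ₀ e ≡ tree i × Freed e) (src e) (tgt e))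
    freed-span origin = return λ i e σe fe → conn-edge (σe , fe)
    freed-span (move {σ} {z} {y} ρ z-free sw) = do
      old ← freed-span ρ
      new ← freed-join ρ z-free
      return λ i e σe fe → [ (λ { refl → conn-bind (λ (t , f) → old i _ t f) (new i) })
                             , (λ e≢z → old i e (swap-⊆ z-free sw (λ ()) e≢z σe) fe) ]′ (cases e)
      where
      cases : ∀ e → e ≡ z ⊎ e ≢ z
      cases e with e ≟ᶠ z
      ... | yes e≡z = inj₁ e≡z
      ... | no e≢z  = inj₂ e≢z

    freed-conn : ∀ {e} → Freed e → ¬ ¬ (∀ i → Conn (λ e → σ₀ e ≡ tree i × Freed e) (src e) (tgt e))
    freed-conn (σ , ρ , e-free) = do
      span ← freed-span ρ
      c ← freed-join ρ e-free
      return λ i → conn-bind (λ (t , f) → span i _ t f) (c i)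

    HeldFreed : State → Vtx G → Set
    HeldFreed σ x = ∀ {y} → σ y ≡ held → 0 < inc x y → Freed y

    -- A swap keeps the held degree at `x`. An edge held before it is either still held afterwards
    -- or is the one swapped out, which this very swap frees.
    held-back : ∀ {σ} → Reach σ → ∀ {x} → x ∈ X →
      deg (holds σ) x ≡ deg (holds σ₀) x × (HeldFreed σ x → HeldFreed σ₀ x)
    held-back origin x∈X = refl , λ hf {y} → hf {y}
    held-back (move {σ} {z} {y} ρ z-free sw) {x} x∈X = let eq , back = held-back ρ x∈X in
      trans (swap-deg z-free sw x∈X) eq , λ hf {e} → back (earlier hf) {e}
      where
      earlier : HeldFreed (swap σ z y) x → HeldFreed σ x
      earlier hf {e} σe xe with e ≟ᶠ y
      ... | yes refl = freed ρ z-free sw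
      ... | no e≢y   = hf (swap-⊇ z-free sw (λ ()) e≢y σe) xe

    -- In a state where `e` is free, `x` is saturated and every held edge at `x` can be swapped for
    -- `e`; `held-back` carries both facts to `σ₀`.
    freed-held : ∀ {e x} → Freed e → x ∈ X → 0 < inc x e → deg (holds σ₀) x ≡ g x × HeldFreed σ₀ x
    freed-held (σ , ρ , e-free) x∈X xe = let eq , back = held-back ρ x∈X in
        trans (sym eq) (saturated ρ e-free x∈X xe)
      , λ {y} → back (λ σy xy → freed ρ e-free (at-vertex σy x∈X xe xy)) {y}

-- Deciding the existence of the trail.

module Decidability (G : Graph) (f : Vtx G → ℕ) (X : Subset (n G)) where

  short? : ∀ k {P : Steps G → Set} → (∀ s → Dec (P s)) → Dec (∃ λ s → length s ≤ k × P s)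
  short? zero P? = map′ (λ p → [] , z≤n , p) (λ { ([] , _ , p) → p }) (P? [])
  short? (suc k) P? = map′
    [ (λ p → [] , z≤n , p) , (λ (e , v , s , s≤k , p) → (e , v) ∷ s , s≤s s≤k , p) ]′
    (λ { ([] , _ , p) → inj₁ p ; ((e , v) ∷ s , s≤s s≤k , p) → inj₂ (e , v , s , s≤k , p) })
    (P? [] ⊎-dec any? λ e → any? λ v → short? k (λ s → P? ((e , v) ∷ s)))

  validWalk? : ∀ u s → Dec (ValidWalk G u s)
  validWalk? u []            = yes tt
  validWalk? u ((e , v) ∷ s) =
    (×-≡-dec _≟ᶠ_ _≟ᶠ_ (ends G e) (u , v) ⊎-dec ×-≡-dec _≟ᶠ_ _≟ᶠ_ (ends G e) (v , u)) ×-dec validWalk? v s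

  closedTrail? : ∀ u s → Dec (IsClosedTrail G u s)
  closedTrail? u s = (validWalk? u s ×-dec DecUnique.unique? _≟ᶠ_ (map proj₁ s)) ×-dec (walkEnd G u s ≟ᶠ u)

  -- A trail repeats no edge, so only the finitely many step lists of length at most `E G` have to
  -- be searched.
  hasSCT? : Dec (HasSCT G f X)
  hasSCT? = map′
    (λ (u , s , _ , p) → u , s , p)
    (λ (u , s , p) → u , s , subst (_≤ E G) (length-map proj₁ s)
      (≤-trans (length-unique≤ (λ _ → true) (proj₂ (proj₁ (proj₁ (proj₁ p)))) (λ _ → refl)) (card≤ _)) , p)
    (any? λ u → short? (E G) λ s →
      (closedTrail? u s ×-dec all? (λ v → v ∈ˡ? (u ∷ map proj₂ s)))
      ×-dec all? (λ v → (v ∈? X) →-dec (timesThrough G s v ≤? f v)))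
    where open DecMembership (_≟ᶠ_ {n G}) using () renaming (_∈?_ to _∈ˡ?_)

-- The structure obtained from a state with the most held edges.

exclusive-≤ : ∀ x y z t t′ → (x ≡ true → y ≢ true) → (x ≡ true → z ≢ true) → (y ≡ true → z ≢ true) →
  (x ≡ true ⊎ y ≡ true ⊎ z ≡ true → t ≡ true ⊎ t′ ≡ true) → 𝟙 x + 𝟙 y + 𝟙 z ≤ 𝟙 t + 𝟙 t′
exclusive-≤ x y z t t′ xy xz yz some = ≤-trans (at-most-one x y z xy xz yz) (positive x y z some)
  where
  at-most-one : ∀ x y z → (x ≡ true → y ≢ true) → (x ≡ true → z ≢ true) → (y ≡ true → z ≢ true) →
    𝟙 x + 𝟙 y + 𝟙 z ≤ 𝟙 (x ∨ y ∨ z)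
  at-most-one true  true  _     xy xz yz = contradiction refl (xy refl)
  at-most-one true  false true  xy xz yz = contradiction refl (xz refl)
  at-most-one true  false false xy xz yz = ≤-refl
  at-most-one false true  true  xy xz yz = contradiction refl (yz refl)
  at-most-one false true  false xy xz yz = ≤-refl
  at-most-one false false z     xy xz yz = ≤-refl
  t∨t′ : t ≡ true ⊎ t′ ≡ true → 1 ≤ 𝟙 t + 𝟙 t′
  t∨t′ (inj₁ refl) = s≤s z≤n
  t∨t′ (inj₂ refl) = m≤n+m 1 (𝟙 t)
  positive : ∀ x y z → (x ≡ true ⊎ y ≡ true ⊎ z ≡ true → t ≡ true ⊎ t′ ≡ true) → 𝟙 (x ∨ y ∨ z) ≤ 𝟙 t + 𝟙 t′
  positive true  y     z     some = t∨t′ (some (inj₁ refl))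
  positive false true  z     some = t∨t′ (some (inj₂ (inj₁ refl)))
  positive false false true  some = t∨t′ (some (inj₂ (inj₂ refl)))
  positive false false false some = z≤n

∧-elim : ∀ x {y} → x ∧ y ≡ true → x ≡ true × y ≡ true
∧-elim true eq = refl , eq

not-true : ∀ {x} → x ≢ true → x ≡ false
not-true {false} _ = refl
not-true {true}  h = contradiction refl h

module Extremal (G : Graph) (X : Subset (n G)) (independent : Independent G X) (f : Vtx G → ℕ) where
  open Connectivity G
  open Packing G
  open Trails G

  -- Giving up this many edges at `v` leaves `2 f v + 1`. At a vertex of smaller degree truncation
  -- yields 0, as nothing has to be given up there.
  capacity : Vtx G → ℕ
  capacity v = deg (λ _ → true) v ∸ suc (2 * f v)

  open Exchanges G X independent capacity

  -- F consists of the edges that some sequence of swaps frees; s is the set of those vertices of X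
  -- with at least 2 f v + 1 edges that no edge of F meets.
  record Critical : Set where
    field
      t : Fin 2 → Edge G → Bool
      F : Edge G → Bool
      s : Vtx G → Bool

    degᵗ : Vtx G → ℕ
    degᵗ v = deg (t 0F) v + deg (t 1F) v

    core : Fin 2 → Edge G → Bool
    core i e = t i e ∧ F e

    field
      t-disjoint : ∀ e → t 0F e ≡ true → t 1F e ≢ true
      t-conn     : ∀ i → Connected ⟪ t i ⟫
      t-thin     : ∀ i → card (t i) < n G
      F-conn     : ∀ {e} → F e ≡ true → ∀ i → Conn ⟪ core i ⟫ (src e) (tgt e)
      F-avoids   : ∀ {e v} → F e ≡ true → s v ≡ true → inc v e ≡ 0
      covered    : ∀ {e} → (∀ v → s v ≡ true → inc v e ≡ 0) → F e ≡ true ⊎ t 0F e ≡ true ⊎ t 1F e ≡ true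
      s⊆X        : ∀ {v} → s v ≡ true → v ∈ X
      s-deg      : ∀ {v} → s v ≡ true → suc (2 * f v) ≤ degᵗ v
      X-deg      : ∀ {v} → v ∈ X → s v ≡ false → degᵗ v ≤ suc (2 * f v)

  module FromState (σ : State) (σ-valid : Valid σ) (σ-max : ∀ σ′ → Valid σ′ → card (holds σ′) ≤ card (holds σ))
    where
    open Reachability σ σ-valid σ-max
    open Valid σ-valid using (connected; thin; held-at)

    all : Vtx G → ℕ
    all = deg (λ _ → true)

    SatAvoided : (Edge G → Bool) → Vtx G → Set
    SatAvoided F v = v ∈ X × (∀ e → F e ≡ true → inc v e ≡ 0) × suc (2 * f v) ≤ all v

    spans : (F : Edge G → Bool) → (∀ e → F e ≡ true → Freed e) → (∀ e → Freed e → F e ≡ true) →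
      ¬ ¬ (∀ e → F e ≡ true → ∀ i → Conn (λ e → trees i σ e ∧ F e ≡ true) (src e) (tgt e))
    spans F F⁻ F⁺ = all-¬¬ λ e → by-cases e (F e) refl
      where
      by-cases : ∀ e b → F e ≡ b → ¬ ¬ (F e ≡ true → ∀ i → Conn (λ e → trees i σ e ∧ F e ≡ true) (src e) (tgt e))
      by-cases e false eq = return λ eq′ → contradiction (trans (sym eq) eq′) λ ()
      by-cases e true  eq = do
        c ← freed-conn (F⁻ e eq)
        return λ _ i → conn-map (λ {e} (σe , fe) → cong₂ _∧_ (isTree⁺ i σe) (F⁺ e fe)) (c i)

    module _ (F : Edge G → Bool) (F⁻ : ∀ e → F e ≡ true → Freed e) (F⁺ : ∀ e → Freed e → F e ≡ true)
      (s : Vtx G → Bool) (s⁻ : ∀ v → s v ≡ true → SatAvoided F v) (s⁺ : ∀ v → SatAvoided F v → s v ≡ true)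
      where

      d₀ d₁ dʰ dᶠ : Vtx G → ℕ
      d₀ = deg (trees 0F σ)
      d₁ = deg (trees 1F σ)
      dʰ = deg (holds σ)
      dᶠ = deg (isFree ∘ σ)

      all-split : ∀ v → all v ≡ d₀ v + d₁ v + dʰ v + dᶠ v
      all-split v = trans (∑-cong {E G} (λ e → pointwise (σ e) (inc v e)))
        (trans (∑-+ {E G} _ _) (cong (_+ dᶠ v) (∑-+₃ {E G} _ _ _)))
        where
        pointwise : ∀ r w → 1 * w ≡ 𝟙 (isTree 0F r) * w + 𝟙 (isTree 1F r) * w + 𝟙 (isHeld r) * w + 𝟙 (isFree r) * w
        pointwise (tree 0F) w = solve 1 (λ w → con 1 :* w := con 1 :* w :+ con 0 :+ con 0 :+ con 0) refl w
          where open +-*-Solver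
        pointwise (tree 1F) w = solve 1 (λ w → con 1 :* w := con 1 :* w :+ con 0 :+ con 0) refl w
          where open +-*-Solver
        pointwise held      w = sym (+-identityʳ _)
        pointwise free      w = refl

      -- By the choice of `s`, a vertex of `X` with this degree outside `s` is met by some edge of
      -- `F`, to which `freed-held` applies.
      touched : ∀ {v} → v ∈ X → s v ≡ false → suc (2 * f v) ≤ all v → dʰ v ≡ capacity v × HeldFreed σ v
      touched {v} v∈X sv h≤ with any? (λ e → (F e Data.Bool.≟ true) ×-dec (0 <? inc v e))
      ... | yes (e , Fe , ve) = freed-held (F⁻ e Fe) v∈X ve
      ... | no untouched = contradiction
            (trans (sym sv) (s⁺ v (v∈X , (λ e Fe → n≤0⇒n≡0 (≮⇒≥ (λ ve → untouched (e , Fe , ve)))) , h≤))) λ ()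

      F-covers : ∀ {e} → (∀ v → s v ≡ true → inc v e ≡ 0) → F e ≡ true ⊎ trees 0F σ e ≡ true ⊎ trees 1F σ e ≡ true
      F-covers {e} avoids with σ e in σe
      ... | tree 0F = inj₂ (inj₁ refl)
      ... | tree 1F = inj₂ (inj₂ refl)
      ... | free    = inj₁ (F⁺ e (σ , origin , σe))
      -- A held edge has an end `x` in `X`, and `x` is outside `s` because the edge avoids `s`. Its
      -- presence makes the capacity at `x` positive, so the degree of `x` is large and all edges
      -- held there are freed.
      ... | held    =
        let x , x∈X , xe = held-at σe
            sx≡false = not-true (λ sx → contradiction (avoids x sx) (m<n⇒n≢0 xe))
            held≥1 = begin
              1                            ≤⟨ xe ⟩
              inc x e                      ≡⟨ *-identityˡ (inc x e) ⟨
              1 * inc x e                  ≡⟨ cong (λ r → 𝟙 (isHeld r) * inc x e) σe ⟨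
              𝟙 (holds σ e) * inc x e      ≤⟨ term≤∑ (λ e → 𝟙 (holds σ e) * inc x e) e ⟩
              dʰ x                         ≤⟨ Valid.capacity σ-valid x∈X ⟩
              capacity x                   ∎
        in inj₁ (F⁺ e (proj₂ (touched x∈X sx≡false (<⇒≤ (m<n∸m⇒n<m held≥1))) σe xe))
        where
        open ≤-Reasoning
        m<n∸m⇒n<m : ∀ {a b} → 1 ≤ a ∸ b → b < a
        m<n∸m⇒n<m {a} {b} 1≤ = ≰⇒> λ a≤b → contradiction (m≤n⇒m∸n≡0 a≤b) (m<n⇒n≢0 1≤)

      -- Free edges lie in `F` and so miss `v`; the held ones stay within capacity, and the trees
      -- carry the rest.
      saturated-deg : ∀ {v} → s v ≡ true → suc (2 * f v) ≤ d₀ v + d₁ v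
      saturated-deg {v} sv = +-cancelʳ-≤ (capacity v) _ _ (begin
        suc (2 * f v) + capacity v         ≡⟨ m+[n∸m]≡n h≤ ⟩
        all v                              ≡⟨ all-split v ⟩
        d₀ v + d₁ v + dʰ v + dᶠ v          ≡⟨ cong ((d₀ v + d₁ v + dʰ v) +_) (∑-zero {E G} no-free) ⟩
        d₀ v + d₁ v + dʰ v + 0             ≡⟨ +-identityʳ _ ⟩
        d₀ v + d₁ v + dʰ v                 ≤⟨ +-monoʳ-≤ (d₀ v + d₁ v) (Valid.capacity σ-valid v∈X) ⟩
        d₀ v + d₁ v + capacity v           ∎)
        where
        open ≤-Reasoning
        v∈X = proj₁ (s⁻ v sv)
        h≤ = proj₂ (proj₂ (s⁻ v sv))
        no-free : ∀ e → 𝟙 (isFree (σ e)) * inc v e ≡ 0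
        no-free e with σ e in σe
        ... | tree _ = refl
        ... | held   = refl
        ... | free   = trans (*-identityˡ _) (proj₁ (proj₂ (s⁻ v sv)) e (F⁺ e (σ , origin , σe)))

      -- If the degree is large, the held edges fill the capacity exactly, which leaves at most
      -- `2 f v + 1` edges for the trees.
      unsaturated-deg : ∀ {v} → v ∈ X → s v ≡ false → d₀ v + d₁ v ≤ suc (2 * f v)
      unsaturated-deg {v} v∈X sv with suc (2 * f v) ≤? all v
      ... | no h≰ = ≤-trans (≤-trans (m≤m+n _ (dʰ v)) (≤-trans (m≤m+n _ (dᶠ v)) (≤-reflexive (sym (all-split v))))) (<⇒≤ (≰⇒> h≰))
      ... | yes h≤ = +-cancelʳ-≤ (capacity v) _ _ (begin
        d₀ v + d₁ v + capacity v           ≡⟨ cong ((d₀ v + d₁ v) +_) (proj₁ (touched v∈X sv h≤)) ⟨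
        d₀ v + d₁ v + dʰ v                 ≤⟨ m≤m+n _ (dᶠ v) ⟩
        d₀ v + d₁ v + dʰ v + dᶠ v          ≡⟨ all-split v ⟨
        all v                              ≡⟨ m+[n∸m]≡n h≤ ⟨
        suc (2 * f v) + capacity v         ∎)
        where open ≤-Reasoning

      toCritical : (∀ e → F e ≡ true → ∀ i → Conn (λ e → trees i σ e ∧ F e ≡ true) (src e) (tgt e)) → Critical
      toCritical F-conn = record
        { t          = λ i → trees i σ
        ; F          = F
        ; s          = s
        ; t-disjoint = λ e t₀ t₁ → contradiction (trans (sym (isTree⁻ 0F {σ e} t₀)) (isTree⁻ 1F {σ e} t₁)) λ ()
        ; t-conn     = connected
        ; t-thin     = thin
        ; F-conn     = λ {e} → F-conn e
        ; F-avoids   = λ {e} {v} Fe sv → proj₁ (proj₂ (s⁻ v sv)) e Fe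
        ; covered    = F-covers
        ; s⊆X        = λ {v} sv → proj₁ (s⁻ v sv)
        ; s-deg      = saturated-deg
        ; X-deg      = unsaturated-deg
        }

  critical : TreeConnected G 2 (AllVertices G) → ¬ ¬ Critical
  critical tc = do
    σ₁ , valid₁ ← initial tc
    σ , valid , most ← maximiser Valid (card ∘ holds) (E G) (λ σ _ → card≤ (holds σ)) (σ₁ , valid₁)
    F , F⁻ , F⁺ ← comprehension (Reachability.Freed σ valid most)
    conn ← FromState.spans σ valid most F F⁻ F⁺
    s , s⁻ , s⁺ ← comprehension (FromState.SatAvoided σ valid most F)
    return (FromState.toCritical σ valid most F F⁻ F⁺ s s⁻ s⁺ conn)

-- The two alternatives of the hypothesis.

xor-false : ∀ a b → a xor b ≡ false → a ≡ b
xor-false false false _ = refl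
xor-false true  true  _ = refl

module Cases (G : Graph) (X : Subset (n G)) (independent : Independent G X) (f : Vtx G → ℕ)
  (positive : ∀ v → v ∈ X → 1 ≤ f v) (C : Extremal.Critical G X independent f) where
  open Connectivity G
  open Packing G
  open Trails G
  open Exchanges G X independent (λ _ → 0) using (inc-X)
  open Extremal.Critical C

  S : Subset (n G)
  S = Vec.tabulate s

  S⊆X : S ⊆ X
  S⊆X v∈S = s⊆X (∈-tabulate⁻ v∈S)

  core⁻ : ∀ i {e} → core i e ≡ true → t i e ≡ true × F e ≡ true
  core⁻ i {e} = ∧-elim (t i e)

  core-disjoint : ∀ e → core 0F e ≡ true → core 1F e ≢ true
  core-disjoint e c₀ c₁ = t-disjoint e (proj₁ (core⁻ 0F c₀)) (proj₁ (core⁻ 1F c₁))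

  -- Both cores have the components of `F` as their components.
  core-transfer : ∀ i j {u v} → Conn ⟪ core i ⟫ u v → Conn ⟪ core j ⟫ u v
  core-transfer i j = conn-bind (λ ce → F-conn (proj₂ (core⁻ i ce)) j)

  light-case : Vtx G → (∀ {v} → s v ≡ true → degᵗ v ≤ suc (2 * f v)) → ¬ ¬ HasSCT G f X
  light-case root light = spanning-trail X f none none (t 0F) (t 1F) root
    (λ e → exclusive-≤ false (t 0F e) (t 1F e) true false (λ ()) (λ ()) (t-disjoint e) (λ _ → inj₁ refl))
    (λ w → refl)
    (λ _ → t-conn 1F _ _)
    (λ u v → conn-map inj₂ (t-conn 0F u v))
    (λ v v∈X → subst (_≤ suc (2 * f v)) (sym (cong (λ d → d + deg (t 0F) v + deg (t 1F) v) (∑-zero {E G} (λ _ → refl)))) (bound v∈X))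
    where
    none : Edge G → Bool
    none _ = false
    bound : ∀ {v} → v ∈ X → degᵗ v ≤ suc (2 * f v)
    bound {v} v∈X with s v in sv
    ... | true  = light sv
    ... | false = X-deg v∈X sv

  visited-conn : ∀ {P : Edge G → Set} {u} τ → ValidWalk G u τ → EdgesIn G P τ → ∀ {v} → v ∈ˡ u ∷ map proj₂ τ → Conn P u v
  visited-conn τ             _        _        (here refl) = done
  visited-conn ((e , _) ∷ τ) (j , js) (p , ps) (there v∈)  = step j p (visited-conn τ js ps v∈)

  edgesIn-self : ∀ τ → EdgesIn G ⟪ member (edges τ) ⟫ τ
  edgesIn-self τ = go τ (λ _ → member⁺)
    where
    go : ∀ {P : Edge G → Set} σ → (∀ e → e ∈ˡ edges σ → P e) → EdgesIn G P σ
    go []            h = tt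
    go ((e , _) ∷ σ) h = h e (here refl) , go σ (λ e e∈ → h e (there e∈))

  trail-case : HasSCT G f S → ¬ ¬ HasSCT G f X
  trail-case (u , τs , (closed , spanning) , meets) = do
    -- The edges of the trail inside a component of F are exchanged for the core trees.
    q , q⁻ , q⁺ ← comprehension (λ e → Conn ⟪ core 1F ⟫ (src e) (tgt e))
    spanning-trail X f (J₀ q) (I q) (core 0F) (core 1F) u
      (λ e → exclusive-≤ (J₀ q e) (core 0F e) (core 1F e) true false
        (off-core q q⁺ 0F e) (off-core q q⁺ 1F e) (core-disjoint e) (λ _ → inj₁ refl))
      (same-parity q)
      (λ {e} → [ (λ Ie → q⁻ e (proj₂ (∧-elim (τ e) Ie))) , (λ c → F-conn (proj₂ (core⁻ 0F c)) 1F) ]′)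
      (λ x y → conn-bind (reroute q q⁻) (τ-conn x y))
      (bound q q⁺)
    where
    τ : Edge G → Bool
    τ = member (edges τs)

    τ-conn : Connected ⟪ τ ⟫
    τ-conn x y = conn-trans (conn-sym (from-u x)) (from-u y)
      where
      from-u : ∀ v → Conn ⟪ τ ⟫ u v
      from-u v = visited-conn τs (proj₁ (proj₁ closed)) (edgesIn-self τs) (spanning v)

    module _ (q : Edge G → Bool) where
      J₀ I : Edge G → Bool
      J₀ e = τ e ∧ not (q e)
      I e  = τ e ∧ q e

      -- `J₀` and `I` split the edge set of a closed trail, all of whose degrees are even. So the
      -- join that replaces `I` restores the parities of `J₀`.
      same-parity : ∀ w → parity (deg J₀ w) ≡ parity (deg I w)
      same-parity w = xor-false _ _ (trans (sym (parity-deg-xor J₀ I w))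
        (trans (cong parity (∑-cong {E G} (λ e → cong (λ b → 𝟙 b * inc w e) (recombine (τ e) (q e)))))
               (closed-even τs closed w)))
        where
        recombine : ∀ a b → (a ∧ not b) xor (a ∧ b) ≡ a
        recombine false b     = refl
        recombine true  false = refl
        recombine true  true  = refl

      reroute : (∀ e → q e ≡ true → Conn ⟪ core 1F ⟫ (src e) (tgt e)) →
        ∀ {e} → τ e ≡ true → Conn (λ e → J₀ e ≡ true ⊎ core 0F e ≡ true) (src e) (tgt e)
      reroute q⁻ {e} τe with q e in qe
      ... | true  = conn-map inj₂ (core-transfer 1F 0F (q⁻ e qe))
      ... | false = conn-edge (inj₁ (cong₂ _∧_ τe (cong not qe)))

      module _ (q⁺ : ∀ e → Conn ⟪ core 1F ⟫ (src e) (tgt e) → q e ≡ true) where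

        J₀⇒¬F : ∀ e → J₀ e ≡ true → F e ≢ true
        J₀⇒¬F e Je Fe = contradiction
          (trans (sym (cong not (q⁺ e (F-conn Fe 1F)))) (proj₂ (∧-elim (τ e) Je))) λ ()

        off-core : ∀ i e → J₀ e ≡ true → core i e ≢ true
        off-core i e Je c = J₀⇒¬F e Je (proj₂ (core⁻ i c))

        bound : ∀ v → v ∈ X → deg J₀ v + deg (core 0F) v + deg (core 1F) v ≤ suc (2 * f v)
        bound v v∈X with s v in sv
        -- No edge of `F` meets `v`, so only trail edges remain, and the given trail is short on
        -- `S`.
        ... | true = begin
          deg J₀ v + deg (core 0F) v + deg (core 1F) v ≡⟨ cong₂ (λ a b → deg J₀ v + a + b) (core-deg 0F) (core-deg 1F) ⟩
          deg J₀ v + 0 + 0                   ≡⟨ trans (+-identityʳ _) (+-identityʳ _) ⟩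
          deg J₀ v                           ≤⟨ ∑-mono {E G} (λ e → *-monoˡ-≤ (inc v e) (𝟙-mono {J₀ e} (proj₁ ∘ ∧-elim (τ e)))) ⟩
          deg τ v                            ≡⟨ closed-degree τs closed v ⟩
          2 * timesThrough G τs v            ≤⟨ *-monoʳ-≤ 2 (meets v (∈-tabulate⁺ sv)) ⟩
          2 * f v                            ≤⟨ n≤1+n _ ⟩
          suc (2 * f v)                      ∎
          where
          open ≤-Reasoning
          core-deg : ∀ i → deg (core i) v ≡ 0
          core-deg i = ∑-zero {E G} pointwise
            where
            pointwise : ∀ e → 𝟙 (core i e) * inc v e ≡ 0
            pointwise e with core i e in ce
            ... | false = refl
            ... | true  = trans (*-identityˡ _) (F-avoids (proj₂ (core⁻ i ce)) sv)
        -- An edge at `v` avoids `s` because `X` is independent, so by `covered` it lies in `F` or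
        -- in a tree. Kept trail edges are not in `F`, hence all edges counted here are tree edges.
        ... | false = begin
          deg J₀ v + deg (core 0F) v + deg (core 1F) v ≡⟨ ∑-+₃ {E G} _ _ _ ⟨
          ∑ (λ e → 𝟙 (J₀ e) * inc v e + 𝟙 (core 0F e) * inc v e + 𝟙 (core 1F e) * inc v e) ≤⟨ ∑-mono {E G} pointwise ⟩
          ∑ (λ e → 𝟙 (t 0F e) * inc v e + 𝟙 (t 1F e) * inc v e) ≡⟨ ∑-+ {E G} _ _ ⟩
          degᵗ v                             ≤⟨ X-deg v∈X sv ⟩
          suc (2 * f v)                      ∎
          where
          open ≤-Reasoning
          avoids : ∀ {e} → 0 < inc v e → ∀ w → s w ≡ true → inc w e ≡ 0
          avoids ve w sw = proj₂ (inc-X v∈X ve) (s⊆X sw) λ { refl → contradiction (trans (sym sv) sw) λ () }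
          in-trees : ∀ e → 0 < inc v e → J₀ e ≡ true ⊎ core 0F e ≡ true ⊎ core 1F e ≡ true → t 0F e ≡ true ⊎ t 1F e ≡ true
          in-trees e ve (inj₁ Je) = [ (λ Fe → contradiction Fe (J₀⇒¬F e Je)) , id ]′ (covered (avoids ve))
          in-trees e ve (inj₂ (inj₁ c)) = inj₁ (proj₁ (core⁻ 0F c))
          in-trees e ve (inj₂ (inj₂ c)) = inj₂ (proj₁ (core⁻ 1F c))
          pointwise : ∀ e → 𝟙 (J₀ e) * inc v e + 𝟙 (core 0F e) * inc v e + 𝟙 (core 1F e) * inc v e
                          ≤ 𝟙 (t 0F e) * inc v e + 𝟙 (t 1F e) * inc v e
          pointwise e with inc v e in ve
          ... | zero  = ≤-reflexive (trans (cong₂ _+_ (cong₂ _+_ (*-zeroʳ (𝟙 (J₀ e))) (*-zeroʳ (𝟙 (core 0F e)))) (*-zeroʳ (𝟙 (core 1F e))))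
                                           (sym (cong₂ _+_ (*-zeroʳ (𝟙 (t 0F e))) (*-zeroʳ (𝟙 (t 1F e))))))
          ... | suc k = subst₂ _≤_
            (trans (*-distribʳ-+ (suc k) (𝟙 (J₀ e) + 𝟙 (core 0F e)) _) (cong (_+ 𝟙 (core 1F e) * suc k) (*-distribʳ-+ (suc k) (𝟙 (J₀ e)) _)))
            (*-distribʳ-+ (suc k) (𝟙 (t 0F e)) _)
            (*-monoˡ-≤ (suc k) (exclusive-≤ (J₀ e) (core 0F e) (core 1F e) (t 0F e) (t 1F e)
              (off-core 0F e) (off-core 1F e) (core-disjoint e) (in-trees e (subst (0 <_) (sym ve) (s≤s z≤n)))))

  -- Counting tree edges against the bound on Ω.

  s-weight : Edge G → ℕ
  s-weight e = ∑ (λ v → 𝟙 (s v) * inc v e)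

  s-weight≤1 : ∀ e → s-weight e ≤ 1
  s-weight≤1 e with s-weight e ≤? 1
  ... | yes ≤1 = ≤1
  ... | no ≰1  = contradiction (≤-reflexive exactly-one) ≰1
    where
    hit = ∑-positive {n G} (λ v → 𝟙 (s v) * inc v e) (<-trans (s≤s z≤n) (≰⇒> ≰1))
    v = proj₁ hit
    factors : ∀ b w → 0 < 𝟙 b * w → b ≡ true × 0 < w
    factors true w pos = refl , subst (0 <_) (*-identityˡ w) pos
    sv = proj₁ (factors (s v) (inc v e) (proj₂ hit))
    ve = proj₂ (factors (s v) (inc v e) (proj₂ hit))
    others : ∀ w → w ≢ v → 𝟙 (s w) * inc w e ≡ 0
    others w w≢v with s w in sw
    ... | false = refl
    ... | true  = trans (*-identityˡ _) (proj₂ (inc-X (s⊆X sv) ve) (s⊆X sw) w≢v)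
    exactly-one : s-weight e ≡ 1
    exactly-one = begin
      s-weight e                       ≡⟨ +-identityʳ _ ⟨
      s-weight e + 0                   ≡⟨ ∑-differ {f = λ w → 𝟙 (s w) * inc w e} {λ _ → 0} v others ⟩
      ∑ {n G} (λ _ → 0) + 𝟙 (s v) * inc v e ≡⟨ cong₂ _+_ (∑-zero {n G} (λ _ → refl)) (cong₂ (λ b k → 𝟙 b * k) sv (proj₁ (inc-X (s⊆X sv) ve))) ⟩
      1                                ∎
      where open ≡-Reasoning

  s-weight-zero : ∀ {e} → s-weight e ≡ 0 → ∀ v → s v ≡ true → inc v e ≡ 0
  s-weight-zero {e} eq v sv = n≤0⇒n≡0 (begin
    inc v e               ≡⟨ *-identityˡ _ ⟨
    1 * inc v e           ≡⟨ cong (λ b → 𝟙 b * inc v e) sv ⟨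
    𝟙 (s v) * inc v e     ≤⟨ term≤∑ (λ v → 𝟙 (s v) * inc v e) v ⟩
    s-weight e            ≡⟨ eq ⟩
    0                     ∎)
    where open ≤-Reasoning

  ∑-degree : ∀ p → ∑ (λ v → 𝟙 (s v) * deg p v) ≡ ∑ (λ e → 𝟙 (p e) * s-weight e)
  ∑-degree p = begin
    ∑ (λ v → 𝟙 (s v) * deg p v)                       ≡⟨ ∑-cong {n G} (λ v → sym (∑-*ˡ {E G} (𝟙 (s v)) (λ e → 𝟙 (p e) * inc v e))) ⟩
    ∑ (λ v → ∑ (λ e → 𝟙 (s v) * (𝟙 (p e) * inc v e))) ≡⟨ ∑-swap {n G} {E G} _ ⟩
    ∑ (λ e → ∑ (λ v → 𝟙 (s v) * (𝟙 (p e) * inc v e))) ≡⟨ ∑-cong {E G} (λ e → trans (∑-cong {n G} (λ v → exchange (𝟙 (s v)) (𝟙 (p e)) (inc v e))) (∑-*ˡ {n G} (𝟙 (p e)) (λ v → 𝟙 (s v) * inc v e))) ⟩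
    ∑ (λ e → 𝟙 (p e) * s-weight e)                    ∎
    where
    open ≡-Reasoning
    exchange : ∀ a b c → a * (b * c) ≡ b * (a * c)
    exchange a b c = trans (sym (*-assoc a b c)) (trans (cong (_* c) (*-comm a b)) (*-assoc b a c))

  U : Subset (n G)
  U = ∁ S

  U⁺ : ∀ {v} → s v ≡ false → v ∈ U
  U⁺ sv = x∉p⇒x∈∁p (λ v∈S → contradiction (trans (sym sv) (∈-tabulate⁻ v∈S)) λ ())

  U⁻ : ∀ {v} → v ∈ U → s v ≡ false
  U⁻ v∈U = not-true (λ sv → x∈∁p⇒x∉p v∈U (∈-tabulate⁺ sv))

  inc-end : ∀ {e u v} → Joins G e u v → 0 < inc v e
  inc-end {e} {u} {v} j rewrite inc-joins {e} v j | δ-refl v = m≤n+m 1 _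

  outside-zero : ∀ {e} → src e ∈ U → tgt e ∈ U → s-weight e ≡ 0
  outside-zero {e} src∈ tgt∈ = ∑-zero {n G} pointwise
    where
    pointwise : ∀ v → 𝟙 (s v) * inc v e ≡ 0
    pointwise v with s v in sv | src e ≟ᶠ v | tgt e ≟ᶠ v
    ... | false | _        | _        = refl
    ... | true  | yes refl | _        = contradiction (trans (sym sv) (U⁻ src∈)) λ ()
    ... | true  | no _     | yes refl = contradiction (trans (sym sv) (U⁻ tgt∈)) λ ()
    ... | true  | no _     | no _     = refl

  F-zero : ∀ {e} → F e ≡ true → s-weight e ≡ 0
  F-zero {e} Fe = ∑-zero {n G} pointwise
    where
    pointwise : ∀ v → 𝟙 (s v) * inc v e ≡ 0
    pointwise v with s v in sv
    ... | false = refl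
    ... | true  = trans (*-identityˡ _) (F-avoids Fe sv)

  F-outside : ∀ {e u v} → F e ≡ true → Joins G e u v → v ∈ U
  F-outside Fe j = U⁺ (not-true (λ sv → contradiction (F-avoids Fe sv) (m<n⇒n≢0 (inc-end j))))

  conn-restrict : ∀ {P : Edge G → Set} {R : Vtx G → Set} → (∀ {e u v} → Joins G e u v → P e → R u → R v) →
    ∀ {u v} → R u → Conn P u v → Conn (λ e → P e × R (src e) × R (tgt e)) u v
  conn-restrict closed r done = done
  conn-restrict closed r (step (inj₁ refl) p c) = let r′ = closed (inj₁ refl) p r in
    step (inj₁ refl) (p , r , r′) (conn-restrict closed r′ c)
  conn-restrict closed r (step (inj₂ refl) p c) = let r′ = closed (inj₂ refl) p r in
    step (inj₂ refl) (p , r′ , r) (conn-restrict closed r′ c)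

  -- The two cores are disjoint, and each connects the whole component of `F`. Membership in the
  -- component is not decided, so it passes through `comprehension` before the cores are restricted
  -- to it.
  core-component : ∀ {e} → F e ≡ true → ¬ ¬ Packed 2 (Conn ⟪ core 0F ⟫ (src e))
  core-component {e₀} Fe₀ = do
    w , w⁻ , w⁺ ← comprehension W
    let B = λ i e → core i e ∧ w (src e)
    return ( (src e₀ , done) , B
           , (λ i e Be → let ce , we = ∧-elim (core i e) Be in
                w⁻ _ we , closed i (inj₁ refl) ce (w⁻ _ we))
           , (λ i u v u∈ v∈ → conn-map (λ {e} (ce , we , _) → cong₂ _∧_ ce (w⁺ _ we))
                (conn-restrict (closed i) u∈ (core-transfer 0F i (conn-trans (conn-sym u∈) v∈))))
           , λ { 0F 0F e ne _ _ → ne refl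
               ; 0F 1F e _ b b′ → core-disjoint e (proj₁ (∧-elim (core 0F e) b)) (proj₁ (∧-elim (core 1F e) b′))
               ; 1F 0F e _ b b′ → core-disjoint e (proj₁ (∧-elim (core 0F e) b′)) (proj₁ (∧-elim (core 1F e) b))
               ; 1F 1F e ne _ _ → ne refl })
    where
    W : Vtx G → Set
    W = Conn ⟪ core 0F ⟫ (src e₀)
    closed : ∀ i {e u v} → Joins G e u v → core i e ≡ true → W u → W v
    closed i j ce wu = conn-trans wu (at-ends (Conn _) conn-sym j (F-conn (proj₂ (core⁻ i ce)) 0F))

  module Counting (k : ℕ) (c : Vtx G → ℕ) (partition : IsComponentPartition G 2 U k c)
    (same : ∀ W → (∀ v → W v → v ∈ U) → Packed 2 W → ∀ {x y} → W x → W y → c x ≡ c y)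
    where

    -- The component of `F` containing `e` avoids `S` and is packed, so it lies in one class.
    -- Consequently no crossing edge belongs to `F`.
    F-class : ∀ {e} → F e ≡ true → c (src e) ≡ c (tgt e)
    F-class {e} Fe = decidable-stable (c (src e) ≟ c (tgt e)) do
      packed ← core-component Fe
      return (same (Conn ⟪ core 0F ⟫ (src e))
        (λ v conn → conn-resp (_∈ U) (λ j ce _ → F-outside (proj₂ (core⁻ 0F ce)) j) conn (F-outside Fe (inj₂ refl)))
        packed done (F-conn Fe 0F))

    classTrees : (j : Fin k) → TreeConnected G 2 (class G U c (toℕ j))
    classTrees j = proj₁ (proj₂ (proj₂ partition)) (toℕ j) (toℕ<n j)

    InClassTree : Fin 2 → Edge G → Set
    InClassTree i e = ∃ λ j → e ∈ proj₁ (classTrees j) i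

    crosses : Edge G → Bool
    crosses = crossing G U c

    crosses⁻ : ∀ e → crosses e ≡ true → src e ∈ U × tgt e ∈ U × c (src e) ≢ c (tgt e)
    crosses⁻ e x with src e ∈? U | tgt e ∈? U | c (src e) ≟ c (tgt e)
    ... | yes s∈ | yes t∈ | no c≢ = s∈ , t∈ , c≢

    module _ (a : Fin 2 → Edge G → Bool) (a⁻ : ∀ i e → a i e ≡ true → InClassTree i e)
      (a⁺ : ∀ i e → InClassTree i e → a i e ≡ true) where

      a-inside : ∀ i {e} → a i e ≡ true → src e ∈ U × tgt e ∈ U × c (src e) ≡ c (tgt e)
      a-inside i {e} ae =
        let j , e∈ = a⁻ i e ae
            (s∈ , cs) , (t∈ , ct) = proj₁ (proj₁ (proj₂ (classTrees j)) i) e e∈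
        in s∈ , t∈ , trans cs (sym ct)

      -- The label at the ends of `e` determines the class whose trees can contain `e`, and within
      -- one class the trees are disjoint.
      a-disjoint : ∀ e → a 0F e ≡ true → a 1F e ≢ true
      a-disjoint e a₀ a₁ with a⁻ 0F e a₀ | a⁻ 1F e a₁
      ... | j , e∈ | j′ , e∈′ with toℕ-injective (trans
              (sym (proj₂ (proj₁ (proj₁ (proj₁ (proj₂ (classTrees j)) 0F) e e∈))))
              (proj₂ (proj₁ (proj₁ (proj₁ (proj₂ (classTrees j′)) 1F) e e∈′))))
      ... | refl = proj₂ (proj₂ (classTrees j)) 0F 1F e (λ ()) e∈ e∈′

      a-conn : ∀ i u v → s u ≡ false → s v ≡ false → c u ≡ c v → Conn ⟪ a i ⟫ u v
      a-conn i u v su sv eq =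
        let u<k = proj₁ partition u (U⁺ su)
            j = fromℕ< u<k
            cu = sym (toℕ-fromℕ< u<k)
            τ , js , τ⊆ , end = proj₁ (proj₂ (proj₂ (proj₁ (proj₂ (classTrees j)) i))) u v
              (U⁺ su , cu) (U⁺ sv , trans (sym eq) cu)
        in conn-map (λ {e} e∈ → a⁺ i e (j , e∈)) (subst (Conn _ u) end (walk⇒conn τ js τ⊆))

      -- Replacing the part of the class trees inside F by the corresponding part of t i keeps the
      -- classes connected and puts b 0F and b 1F inside the union of the two trees t i.
      b : Fin 2 → Edge G → Bool
      b i e = core i e ∨ (a i e ∧ not (F e))

      b⁻ : ∀ i {e} → b i e ≡ true → core i e ≡ true ⊎ (a i e ≡ true × F e ≡ false)
      b⁻ i {e} = ∨-∧-not-elim (core i e) (a i e) (F e)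

      b-conn : ∀ i u v → s u ≡ false → s v ≡ false → c u ≡ c v → Conn ⟪ b i ⟫ u v
      b-conn i u v su sv eq = conn-bind covered-by-b (a-conn i u v su sv eq)
        where
        covered-by-b : ∀ {e} → a i e ≡ true → Conn ⟪ b i ⟫ (src e) (tgt e)
        covered-by-b {e} ae = by-cases (F e) refl
          where
          by-cases : ∀ x → F e ≡ x → Conn ⟪ b i ⟫ (src e) (tgt e)
          by-cases true  Fe = conn-map (∨-introˡ _) (F-conn Fe i)
          by-cases false Fe = conn-edge (∨-introʳ (core i e) (cong₂ _∧_ ae (cong not Fe)))

      b-count : ∀ i → n G ≤ card (b i) + (k + card s)
      b-count i = n≤edges+classes (b i) s k c (λ v sv → proj₁ partition v (U⁺ sv)) (b-conn i)

      b-same-class : ∀ i {e} → b i e ≡ true → c (src e) ≡ c (tgt e)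
      b-same-class i be = [ F-class ∘ proj₂ ∘ core⁻ i , (λ (ae , _) → proj₂ (proj₂ (a-inside i ae))) ]′ (b⁻ i be)

      b-zero : ∀ i {e} → b i e ≡ true → s-weight e ≡ 0
      b-zero i be = [ F-zero ∘ proj₂ ∘ core⁻ i
                    , (λ (ae , _) → let s∈ , t∈ , _ = a-inside i ae in outside-zero s∈ t∈) ]′ (b⁻ i be)

      b-disjoint : ∀ e → b 0F e ≡ true → b 1F e ≢ true
      b-disjoint e b₀ b₁ with b⁻ 0F b₀ | b⁻ 1F b₁
      ... | inj₁ c₀        | inj₁ c₁        = core-disjoint e c₀ c₁
      ... | inj₁ c₀        | inj₂ (_ , ¬Fe) = contradiction (trans (sym (proj₂ (core⁻ 0F c₀))) ¬Fe) λ ()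
      ... | inj₂ (_ , ¬Fe) | inj₁ c₁        = contradiction (trans (sym (proj₂ (core⁻ 1F c₁))) ¬Fe) λ ()
      ... | inj₂ (a₀ , _)  | inj₂ (a₁ , _)  = a-disjoint e a₀ a₁

      -- Class trees live outside `S`, and an edge outside `S` that is not in `F` has to be a tree
      -- edge by `covered`.
      a-in-trees : ∀ i {e} → a i e ≡ true × F e ≡ false → t 0F e ≡ true ⊎ t 1F e ≡ true
      a-in-trees i (ae , ¬Fe) = let s∈ , t∈ , _ = a-inside i ae in
        [ (λ Fe → contradiction (trans (sym Fe) ¬Fe) λ ()) , id ]′ (covered (s-weight-zero (outside-zero s∈ t∈)))

      in-trees : ∀ {e} → crosses e ≡ true ⊎ b 0F e ≡ true ⊎ b 1F e ≡ true → t 0F e ≡ true ⊎ t 1F e ≡ true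
      in-trees {e} (inj₁ x) = let s∈ , t∈ , c≢ = crosses⁻ e x in
        [ (λ Fe → contradiction (F-class Fe) c≢) , id ]′ (covered (s-weight-zero (outside-zero s∈ t∈)))
      in-trees {e} (inj₂ (inj₁ be)) = [ inj₁ ∘ proj₁ ∘ core⁻ 0F , a-in-trees 0F ]′ (b⁻ 0F be)
      in-trees {e} (inj₂ (inj₂ be)) = [ inj₂ ∘ proj₁ ∘ core⁻ 1F , a-in-trees 1F ]′ (b⁻ 1F be)

      -- Every edge of the two trees is charged at most once. If it avoids `S`, it is at most one of
      -- crossing, in `b 0F` and in `b 1F`; if it meets `S`, it is none of these and has exactly one
      -- end there.
      edge-count : ∀ e → 𝟙 (crosses e) + 𝟙 (b 0F e) + 𝟙 (b 1F e) + (𝟙 (t 0F e) + 𝟙 (t 1F e)) * s-weight e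
                       ≤ 𝟙 (t 0F e) + 𝟙 (t 1F e)
      edge-count e with s-weight e in we | s-weight≤1 e
      ... | zero | _ = ≤-trans (≤-reflexive (trans
        (cong ((𝟙 (crosses e) + 𝟙 (b 0F e) + 𝟙 (b 1F e)) +_) (*-zeroʳ (𝟙 (t 0F e) + 𝟙 (t 1F e))))
        (+-identityʳ (𝟙 (crosses e) + 𝟙 (b 0F e) + 𝟙 (b 1F e)))))
        (exclusive-≤ (crosses e) (b 0F e) (b 1F e) (t 0F e) (t 1F e)
          (λ x b₀ → proj₂ (proj₂ (crosses⁻ e x)) (b-same-class 0F b₀))
          (λ x b₁ → proj₂ (proj₂ (crosses⁻ e x)) (b-same-class 1F b₁))
          (b-disjoint e) in-trees)
      ... | suc (suc _) | s≤s ()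
      ... | suc zero | _ = ≤-reflexive (begin
        𝟙 (crosses e) + 𝟙 (b 0F e) + 𝟙 (b 1F e) + h * 1
          ≡⟨ cong₂ (λ x y → 𝟙 x + 𝟙 y + 𝟙 (b 1F e) + h * 1)
               (not-true (λ x → let s∈ , t∈ , _ = crosses⁻ e x in nonzero (outside-zero s∈ t∈)))
               (not-true (nonzero ∘ b-zero 0F)) ⟩
        𝟙 (b 1F e) + h * 1
          ≡⟨ cong₂ (λ x y → 𝟙 x + y) (not-true (nonzero ∘ b-zero 1F)) (*-identityʳ h) ⟩
        h ∎)
        where
        open ≡-Reasoning
        h = 𝟙 (t 0F e) + 𝟙 (t 1F e)
        nonzero : s-weight e ≢ 0
        nonzero eq = contradiction (trans (sym we) eq) λ ()

      s-degree : ℕ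
      s-degree = ∑ (λ v → 𝟙 (s v) * degᵗ v)

      total : card crosses + card (b 0F) + card (b 1F) + s-degree ≤ card (t 0F) + card (t 1F)
      total = begin
        card crosses + card (b 0F) + card (b 1F) + s-degree
          ≡⟨ cong₂ _+_ (sym (∑-+₃ {E G} _ _ _)) s-degree-edges ⟩
        ∑ (λ e → 𝟙 (crosses e) + 𝟙 (b 0F e) + 𝟙 (b 1F e)) + ∑ (λ e → (𝟙 (t 0F e) + 𝟙 (t 1F e)) * s-weight e)
          ≡⟨ ∑-+ {E G} _ _ ⟨
        ∑ (λ e → 𝟙 (crosses e) + 𝟙 (b 0F e) + 𝟙 (b 1F e) + (𝟙 (t 0F e) + 𝟙 (t 1F e)) * s-weight e)
          ≤⟨ ∑-mono {E G} edge-count ⟩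
        ∑ (λ e → 𝟙 (t 0F e) + 𝟙 (t 1F e))
          ≡⟨ ∑-+ {E G} _ _ ⟩
        card (t 0F) + card (t 1F) ∎
        where
        open ≤-Reasoning
        s-degree-edges : s-degree ≡ ∑ (λ e → (𝟙 (t 0F e) + 𝟙 (t 1F e)) * s-weight e)
        s-degree-edges = trans (∑-cong {n G} (λ v → *-distribˡ-+ (𝟙 (s v)) (deg (t 0F) v) _))
          (trans (∑-+ {n G} _ _) (trans (cong₂ _+_ (∑-degree (t 0F)) (∑-degree (t 1F)))
            (trans (sym (∑-+ {E G} _ _)) (∑-cong {E G} (λ e → sym (*-distribʳ-+ (s-weight e) (𝟙 (t 0F e)) _))))))

      -- `2 f v + 1` splits into `2 f v - 1`, the summand in the bound on Ω, and 2: a vertex of `S`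
      -- is counted on its own once for each of `b 0F` and `b 1F` in `b-count`.
      excess : ∀ v → s v ≡ true → suc (2 * f v) < degᵗ v →
        sumOver G S (λ v → 2 * f v ∸ 1) + 2 * card s < s-degree
      excess v₀ sv₀ heavy = subst (_< s-degree) (trans (∑-cong {n G} rewrite-term)
          (trans (∑-+ {n G} _ _) (cong₂ _+_ (sym (∑-list {n G} _)) (∑-*ˡ {n G} 2 _))))
        (∑-mono-< {n G} below v₀ (subst (λ x → 𝟙 x * suc (2 * f v₀) < 𝟙 x * degᵗ v₀) (sym sv₀) (*-monoʳ-< 1 heavy)))
        where
        below : ∀ v → 𝟙 (s v) * suc (2 * f v) ≤ 𝟙 (s v) * degᵗ v
        below v with s v in sv
        ... | false = z≤n
        ... | true  = *-monoʳ-≤ 1 (s-deg sv)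
        rewrite-term : ∀ v → 𝟙 (s v) * suc (2 * f v) ≡ (if ⌊ v ∈? S ⌋ then 2 * f v ∸ 1 else 0) + 2 * 𝟙 (s v)
        rewrite-term v with v ∈? S
        ... | no v∉S rewrite not-true {s v} (v∉S ∘ ∈-tabulate⁺) = refl
        -- Positivity of `f v` keeps `2 * f v ∸ 1` from being truncated.
        ... | yes v∈S rewrite ∈-tabulate⁻ {p = s} v∈S with f v | positive v (S⊆X v∈S)
        ...   | suc k | _ = solve 1 (λ k → con 1 :* (con 1 :+ con 2 :* (con 1 :+ k)) := (k :+ (con 1 :+ (k :+ con 0))) :+ con 2) refl k
          where open +-*-Solver

      -- Each `t i` has at most `n G` minus one edges, a loss of 2 in total. This is exactly the 2
      -- added in the bound on Ω, so no slack remains for a vertex of `S` with tree degree above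
      -- `2 f v + 1`.
      Ω-large : ∀ v → s v ≡ true → suc (2 * f v) < degᵗ v →
        ¬ (Ω G 2 U k c ℤ.≤ ℤ.+ (sumOver G S (λ v → 2 * f v ∸ 1) + 2))
      Ω-large v sv heavy Ω≤ = <-irrefl refl (begin-strict
        t₀ + t₁ + 2                                    ≡⟨ solve 2 (λ x y → x :+ y :+ con 2 := (con 1 :+ x) :+ (con 1 :+ y)) refl t₀ t₁ ⟩
        suc t₀ + suc t₁                                ≤⟨ +-mono-≤ (≤-trans (t-thin 0F) (b-count 0F)) (≤-trans (t-thin 1F) (b-count 1F)) ⟩
        (b₀ + (k + σ)) + (b₁ + (k + σ))                ≡⟨ solve 4 (λ b₀ b₁ k σ → (b₀ :+ (k :+ σ)) :+ (b₁ :+ (k :+ σ)) := b₀ :+ b₁ :+ con 2 :* σ :+ con 2 :* k) refl b₀ b₁ k σ ⟩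
        b₀ + b₁ + 2 * σ + 2 * k                        ≤⟨ +-monoʳ-≤ (b₀ + b₁ + 2 * σ) 2k≤ ⟩
        b₀ + b₁ + 2 * σ + (W + 2 + x)                  ≡⟨ solve 5 (λ b₀ b₁ σ W x → b₀ :+ b₁ :+ con 2 :* σ :+ (W :+ con 2 :+ x) := x :+ b₀ :+ b₁ :+ (W :+ con 2 :* σ) :+ con 2) refl b₀ b₁ σ W x ⟩
        x + b₀ + b₁ + (W + 2 * σ) + 2                  <⟨ +-monoˡ-< 2 (+-monoʳ-< (x + b₀ + b₁) (excess v sv heavy)) ⟩
        x + b₀ + b₁ + s-degree + 2                     ≤⟨ +-monoˡ-≤ 2 total ⟩
        t₀ + t₁ + 2                                    ∎)
        where
        open ≤-Reasoning
        open +-*-Solver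
        t₀ = card (t 0F)
        t₁ = card (t 1F)
        b₀ = card (b 0F)
        b₁ = card (b 1F)
        σ = card s
        x = card crosses
        W = sumOver G S (λ v → 2 * f v ∸ 1)
        crossingCount≡ : crossingCount G U c ≡ x
        crossingCount≡ = trans (length-filter crosses (allFin (E G))) (∑-list {E G} _)
        cancel : ∀ i j → (i ℤ.- j) ℤ.+ j ≡ i
        cancel i j = trans (ℤ.+-assoc i (ℤ.- j) j) (trans (cong (λ d → i ℤ.+ d) (ℤ.+-inverseˡ j)) (ℤ.+-identityʳ i))
        2k≤ : 2 * k ≤ W + 2 + x
        2k≤ = ℤ.drop‿+≤+ (subst₂ ℤ._≤_ (cancel (ℤ.+ (2 * k)) (ℤ.+ crossingCount G U c))
          (cong (λ y → ℤ.+ (W + 2 + y)) crossingCount≡) (ℤ.+-monoˡ-≤ (ℤ.+ crossingCount G U c) Ω≤))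

  heavy-case : ∀ v → s v ≡ true → suc (2 * f v) < degᵗ v →
    ¬ ((k : ℕ) (c : Vtx G → ℕ) → IsComponentPartition G 2 U k c →
       Ω G 2 U k c ℤ.≤ ℤ.+ (sumOver G S (λ v → 2 * f v ∸ 1) + 2))
  heavy-case v sv heavy Ω≤ = absurd id
    where
    absurd : ¬ ¬ ⊥
    absurd = do
      k , c , partition , same ← Components.component-partition 1 U
      let open Counting k c partition same
      a ← all-¬¬ (λ i → comprehension (InClassTree i))
      return (Ω-large (proj₁ ∘ a) (proj₁ ∘ proj₂ ∘ a) (proj₂ ∘ proj₂ ∘ a) v sv heavy (Ω≤ k c partition))

  conclusion : Vtx G →
    HasSCT G f S
    ⊎ ((k : ℕ) (c : Vtx G → ℕ) → IsComponentPartition G 2 U k c →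
       Ω G 2 U k c ℤ.≤ ℤ.+ (sumOver G S (λ v → 2 * f v ∸ 1) + 2)) →
    ¬ ¬ HasSCT G f X
  conclusion root (inj₁ sct) = trail-case sct
  conclusion root (inj₂ Ω≤)  = light-case root λ {v} sv → ≮⇒≥ λ heavy → heavy-case v sv heavy Ω≤

open import Data.Integer using (+_)

theorem7p5 : (G : Graph) → TreeConnected G 2 (AllVertices G) →
    (X : Subset (n G)) → Independent G X →
    (f : Vtx G → ℕ) → (∀ v → v ∈ X → 1 ≤ f v) →
    ((S : Subset (n G)) → S ⊆ X →
    HasSCT G f S
    ⊎ ((k : ℕ) (c : Vtx G → ℕ) → IsComponentPartition G 2 (∁ S) k c →
    Ω G 2 (∁ S) k c ℤ.≤ + (sumOver G S (λ v → 2 * f v ∸ 1) + 2))) →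
    HasSCT G f X
theorem7p5 G tc X independent f positive alternative = decidable-stable (Decidability.hasSCT? G f X) do
  C ← Extremal.critical G X independent f tc
  let open Cases G X independent f positive C
  -- The root is the vertex that witnesses nonemptiness in the first spanning tree. The hypothesis
  -- is applied only to the set `S` read off from the extremal state.
  conclusion (proj₁ (proj₁ (proj₂ (proj₁ (proj₂ tc) 0F)))) (alternative S S⊆X)
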